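{- For $q=3,4,6$ let $\chi_q$ be the primitive character with conductor $q$ given by $\chi_q(1)=1$, $\chi_q(q-1)=-1$, and $\chi_q(a)=0$ for all other $a$ with $1\le a\le q$. Then for $q=3,4,6$ and for all integers $m\geq 0$ we have $H_{2m}(B_{k,\chi_q})=0$ and $$H_{2m+1}(B_{k,\chi_q})=(-1)^{m+1}\left(q^{m-1}(q-2)\right)^{2m+2}\prod_{\ell=1}^m\left(\frac{\ell^4\big((q-2)^2-(q\ell)^2\big)}{4(2\ell+1)(2\ell-1)}\right)^{2(m+1-\ell)}.$$
   Context: For a primitive character $\chi$ with conductor $q$, the generalized Bernoulli numbers $B_{n,\chi}$ belonging to $\chi$ are defined by $\sum_{a=1}^q\frac{\chi(a)te^{at}}{e^{qt}-1}=\sum_{n=0}^\infty B_{n,\chi}\frac{t^n}{n!}$. For a sequence $(c_0,c_1,\ldots)$ (indexed from $k=0$), $H_n(c_k)=\det\big(c_{i+j}\big)_{0\le i,j\le n}$ denotes its $n$th Hankel determinant. -}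

module Defs where

open import Data.Bool.Base using (if_then_else_)
open import Data.Fin.Base using (Fin; zero; suc; toℕ; fromℕ<; punchIn)
open import Data.Fin.Properties using (all?; toℕ-fromℕ<)
open import Data.Integer.Base as ℤ using (ℤ; +_; -[1+_])
import Data.Integer.Properties as ℤₚ
open import Data.Nat.Base as ℕ using (ℕ; zero; suc; NonZero; _∸_; _%_; _!)
open import Data.Nat.Coprimality using (Coprime; coprime?)
open import Data.Nat.Divisibility using (%-presˡ-∣; ∣n∣m%n⇒∣m)
open import Data.Nat.DivMod using (m%n<n; m%n%n≡m%n; [m+n]%n≡m%n; %-distribˡ-*)
import Data.Nat.Properties as ℕₚ
open import Data.Product.Base using (_,_)
open import Data.Rational.Base as ℚ
  using (ℚ; 0ℚ; 1ℚ; _+_; _*_; _-_; -_; _/_; 1/_; toℚᵘ; fromℚᵘ; +-*-rawSemiring)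
import Data.Rational.Properties as ℚₚ
open import Data.Rational.Unnormalised.Base as ℚᵘ using (mkℚᵘ; *≡*)
import Data.Rational.Unnormalised.Properties as ℚᵘₚ
open import Data.Sum.Base using (_⊎_; inj₁; inj₂)
open import Algebra.Definitions.RawSemiring +-*-rawSemiring using (_^_; sum; product)
open import Function.Base using (_∘_)
open import Function.Bundles using (_⇔_; mk⇔)
open import Relation.Binary.PropositionalEquality
open import Relation.Nullary.Decidable
  using (Dec; toWitness; _→-dec_; ¬?; does)

fromℕ : ℕ → ℚ
fromℕ n = + n / 1

infixr 8 _^ᶻ_

_^ᶻ_ : (b : ℕ) .{{_ : NonZero b}} → ℤ → ℚ
b ^ᶻ (+ n)    = fromℕ b ^ n
b ^ᶻ -[1+ n ] = (+ 1 / b) ^ suc n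

-- ∏₁ m f is the product of f ℓ over 1 ≤ ℓ ≤ m.
∏₁ : (m : ℕ) → ((ℓ : ℕ) .{{_ : NonZero ℓ}} → ℚ) → ℚ
∏₁ m f = product {m} (λ i → f (suc (toℕ i)))

Matrix : ℕ → Set
Matrix n = Fin n → Fin n → ℚ

det : ∀ {n} → Matrix n → ℚ
det {zero}  M = 1ℚ
det {suc n} M =
  sum (λ j → (- 1ℚ) ^ toℕ j * M zero j * det (λ i k → M (suc i) (punchIn j k)))

-- The matrix has size n + 1, since 0 ≤ i, j ≤ n.
H : ℕ → (ℕ → ℚ) → ℚ
H n c = det {suc n} (λ i j → c (toℕ i ℕ.+ toℕ j))

Series : Set
Series = ℕ → ℚ

one : Series
one zero    = 1ℚ
one (suc _) = 0ℚ

infixl 6 _⊖_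
infixl 7 _⊛_ _⊘_

_⊖_ : Series → Series → Series
(f ⊖ g) n = f n - g n

_⊛_ : Series → Series → Series
(f ⊛ g) n = sum {suc n} (λ i → f (toℕ i) * g (n ∸ toℕ i))

t·_ : Series → Series
(t· f) zero    = 0ℚ
(t· f) (suc n) = f n

-- f / t, for f with zero constant term
tail : Series → Series
tail f n = f (suc n)

-- Long division: the constant term of f / g is c = f 0 / g 0, and the
-- remaining coefficients are those of ((f - c g) / t) / g; see ⊘-⊛ below.
_⊘_ : (f g : Series) .{{_ : ℚ.NonZero (g 0)}} → Series
(f ⊘ g) zero    = f 0 * 1/ (g 0)
(f ⊘ g) (suc n) = ((λ k → f (suc k) - f 0 * 1/ (g 0) * g (suc k)) ⊘ g) n

-- e^{ct}
exp : ℕ → Series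
exp c n = _/_ (+ (c ℕ.^ n)) (n !) {{n ℕₚ.!≢0}}

-- Σ bₙ tⁿ / n!
egf : (ℕ → ℚ) → Series
egf b n = b n * _/_ (+ 1) (n !) {{n ℕₚ.!≢0}}

-- Σ_{a=1}^{q} χ(a) e^{at}
charSum : (q : ℕ) → (ℕ → ℚ) → Series
charSum q χ n = sum {q} (λ a → χ (suc (toℕ a)) * exp (suc (toℕ a)) n)

private
  fromℕ-nonZero : ∀ q .{{_ : NonZero q}} → ℚ.NonZero (fromℕ q)
  fromℕ-nonZero (suc n) = ℚₚ.pos⇒nonZero (fromℕ (suc n)) {{ℚₚ.normalize-pos (suc n) 1}}

  const-term : ∀ q → tail (exp q ⊖ one) 0 ≡ fromℕ q
  const-term q = trans (ℚₚ.+-identityʳ _) (cong (λ k → + k / 1) (ℕₚ.*-identityʳ q))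

  instance
    const-term-nonZero : ∀ {q} .{{_ : NonZero q}} → ℚ.NonZero (tail (exp q ⊖ one) 0)
    const-term-nonZero {q} = subst ℚ.NonZero (sym (const-term q)) (fromℕ-nonZero q)

-- The factor t common to the numerator t Σ χ(a) e^{at} and to the
-- denominator e^{qt} - 1 is cancelled before dividing.  The defining
-- identity of the generating function is genBernoulli-egf below.
genBernoulli : (q : ℕ) .{{_ : NonZero q}} → (ℕ → ℚ) → ℕ → ℚ
genBernoulli q χ n = fromℕ (n !) * (charSum q χ ⊘ tail (exp q ⊖ one)) n

-- The characters χ_q, extended q-periodically.  For q = 6 this is a
-- character modulo 6 that is induced from modulus 3; the generalized
-- Bernoulli numbers are formed with the modulus q = 6.
χ : (q : ℕ) .{{_ : NonZero q}} → ℕ → ℚ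
χ q a =
  if does (a % q ℕₚ.≟ 1)       then 1ℚ   else
  if does (a % q ℕₚ.≟ (q ∸ 1)) then - 1ℚ else
  0ℚ

record IsDirichletCharacter (q : ℕ) (ψ : ℕ → ℚ) : Set where
  field
    periodic       : ∀ a → ψ (a ℕ.+ q) ≡ ψ a
    multiplicative : ∀ a b → ψ (a ℕ.* b) ≡ ψ a * ψ b
    unital         : ψ 1 ≡ 1ℚ
    support        : ∀ a → Coprime a q ⇔ (ψ a ≢ 0ℚ)

-- ℓ⁴ ((q-2)² - (qℓ)²) / (4 (2ℓ+1) (2ℓ-1)); the truncated subtraction
-- 2ℓ ∸ 1 is exact because ℓ ≥ 1.
factor : (q ℓ : ℕ) .{{_ : NonZero ℓ}} → ℚ
factor q ℓ =
  _/_ ((+ ℓ) ℤ.^ 4 ℤ.* ((+ q ℤ.- + 2) ℤ.^ 2 ℤ.- (+ q ℤ.* + ℓ) ℤ.^ 2))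
      (4 ℕ.* (2 ℕ.* ℓ ℕ.+ 1) ℕ.* (2 ℕ.* ℓ ∸ 1))
      {{denominator≢0 ℓ}}
  where
  denominator≢0 : ∀ ℓ .{{_ : NonZero ℓ}} →
                  NonZero (4 ℕ.* (2 ℕ.* ℓ ℕ.+ 1) ℕ.* (2 ℕ.* ℓ ∸ 1))
  denominator≢0 (suc k) rewrite ℕₚ.+-suc k (k ℕ.+ 0) = _

⊘-⊛ : ∀ f g .{{_ : ℚ.NonZero (g 0)}} → (f ⊘ g) ⊛ g ≗ f
⊘-⊛ f g zero = begin
  f 0 * 1/ (g 0) * g 0 + 0ℚ  ≡⟨ ℚₚ.+-identityʳ _ ⟩
  f 0 * 1/ (g 0) * g 0       ≡⟨ ℚₚ.*-assoc (f 0) _ _ ⟩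
  f 0 * (1/ (g 0) * g 0)     ≡⟨ cong (f 0 *_) (ℚₚ.*-inverseˡ (g 0)) ⟩
  f 0 * 1ℚ                   ≡⟨ ℚₚ.*-identityʳ _ ⟩
  f 0                        ∎
  where open ≡-Reasoning
⊘-⊛ f g (suc n) = begin
  c + ((f′ ⊘ g) ⊛ g) n       ≡⟨ cong (λ x → c + x) (⊘-⊛ f′ g n) ⟩
  c + (f (suc n) - c)        ≡⟨ cong (λ x → c + x) (ℚₚ.+-comm (f (suc n)) (- c)) ⟩
  c + (- c + f (suc n))      ≡⟨ ℚₚ.+-assoc c (- c) _ ⟨
  c - c + f (suc n)          ≡⟨ cong (_+ f (suc n)) (ℚₚ.+-inverseʳ c) ⟩
  0ℚ + f (suc n)             ≡⟨ ℚₚ.+-identityˡ _ ⟩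
  f (suc n)                  ∎
  where
  open ≡-Reasoning
  c  = f 0 * 1/ (g 0) * g (suc n)
  f′ = λ k → f (suc k) - f 0 * 1/ (g 0) * g (suc k)

private
  ⊛-tail : ∀ f g → g 0 ≡ 0ℚ → f ⊛ g ≗ t· (f ⊛ tail g)
  ⊛-tail f g g₀ zero          = trans (ℚₚ.+-identityʳ _)
                                  (trans (cong (f 0 *_) g₀) (ℚₚ.*-zeroʳ (f 0)))
  ⊛-tail f g g₀ (suc zero)    = cong (λ x → f 0 * g 1 + x) (⊛-tail (tail f) g g₀ 0)
  ⊛-tail f g g₀ (suc (suc n)) =
    cong (λ x → f 0 * g (suc (suc n)) + x) (⊛-tail (tail f) g g₀ (suc n))

  sum-cong : ∀ {n} {f g : Fin n → ℚ} → f ≗ g → sum f ≡ sum g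
  sum-cong {zero}  _ = refl
  sum-cong {suc n} e = cong₂ _+_ (e zero) (sum-cong (e ∘ suc))

  fromℕ-inverse : ∀ d .{{_ : NonZero d}} → fromℕ d * (+ 1 / d) ≡ 1ℚ
  fromℕ-inverse d@(suc d-1) = ℚₚ.toℚᵘ-injective (begin
    toℚᵘ (fromℕ d * (+ 1 / d))                  ≈⟨ ℚₚ.toℚᵘ-homo-* (fromℕ d) (+ 1 / d) ⟩
    toℚᵘ (fromℕ d) ℚᵘ.* toℚᵘ (+ 1 / d)          ≈⟨ ℚᵘₚ.*-cong (ℚₚ.toℚᵘ-fromℚᵘ (mkℚᵘ (+ d) 0))
                                                              (ℚₚ.toℚᵘ-fromℚᵘ (mkℚᵘ (+ 1) d-1)) ⟩
    mkℚᵘ (+ d) 0 ℚᵘ.* mkℚᵘ (+ 1) d-1            ≈⟨ *≡* (trans (ℤₚ.*-identityʳ _)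
                                                     (trans (ℤₚ.*-identityʳ (+ d))
                                                     (sym (trans (ℤₚ.*-identityˡ _)
                                                       (cong +_ (ℕₚ.*-identityˡ d)))))) ⟩
    toℚᵘ 1ℚ                                     ∎)
    where open ℚᵘₚ.≃-Reasoning

  egf-! : ∀ (b : ℕ → ℚ) → egf (λ n → fromℕ (n !) * b n) ≗ b
  egf-! b n = begin
    fromℕ (n !) * b n * r    ≡⟨ cong (_* r) (ℚₚ.*-comm (fromℕ (n !)) (b n)) ⟩
    b n * fromℕ (n !) * r    ≡⟨ ℚₚ.*-assoc (b n) _ _ ⟩
    b n * (fromℕ (n !) * r)  ≡⟨ cong (b n *_) (fromℕ-inverse (n !) {{n ℕₚ.!≢0}}) ⟩
    b n * 1ℚ                 ≡⟨ ℚₚ.*-identityʳ (b n) ⟩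
    b n                      ∎
    where
    open ≡-Reasoning
    r = _/_ (+ 1) (n !) {{n ℕₚ.!≢0}}

-- (Σ Bₙ tⁿ / n!) (e^{qt} - 1) = t Σ_{a=1}^{q} ψ(a) e^{at}
genBernoulli-egf : ∀ q .{{_ : NonZero q}} (ψ : ℕ → ℚ) →
                   egf (genBernoulli q ψ) ⊛ (exp q ⊖ one) ≗ t· charSum q ψ
genBernoulli-egf q ψ n =
  trans (sum-cong {suc n} (λ i → cong (_* (exp q ⊖ one) (n ∸ toℕ i)) (egf-! b (toℕ i))))
        (trans (⊛-tail b (exp q ⊖ one) refl n) (shifted n))
  where
  b = charSum q ψ ⊘ tail (exp q ⊖ one)
  shifted : t· (b ⊛ tail (exp q ⊖ one)) ≗ t· charSum q ψ
  shifted zero    = refl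
  shifted (suc k) = ⊘-⊛ (charSum q ψ) (tail (exp q ⊖ one)) k

private
  χ-mod : ∀ q .{{_ : NonZero q}} a b → a % q ≡ b % q → χ q a ≡ χ q b
  χ-mod q a b e rewrite e = refl

  module _ (q : ℕ) .{{_ : NonZero q}}
    (mult : ∀ (i j : Fin q) → χ q (toℕ i ℕ.* toℕ j) ≡ χ q (toℕ i) * χ q (toℕ j))
    (fwd  : ∀ (i : Fin q) → Coprime (toℕ i) q → χ q (toℕ i) ≢ 0ℚ)
    (bwd  : ∀ (i : Fin q) → χ q (toℕ i) ≢ 0ℚ → Coprime (toℕ i) q)
    (unit : χ q 1 ≡ 1ℚ)
    where

    χ-% : ∀ a → χ q (a % q) ≡ χ q a
    χ-% a = χ-mod q (a % q) a (m%n%n≡m%n a q)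

    coprime-% : ∀ a → Coprime a q → Coprime (a % q) q
    coprime-% a c (d∣a%q , d∣q) = c (∣n∣m%n⇒∣m d∣q d∣a%q , d∣q)

    coprime-%⁻¹ : ∀ a → Coprime (a % q) q → Coprime a q
    coprime-%⁻¹ a c (d∣a , d∣q) = c (%-presˡ-∣ d∣a d∣q , d∣q)

    onResidues : (P : ℕ → Set) → (∀ (i : Fin q) → P (toℕ i)) → ∀ a → P (a % q)
    onResidues P p a = subst P (toℕ-fromℕ< (m%n<n a q)) (p (fromℕ< (m%n<n a q)))

    fwd′ : ∀ a → Coprime a q → χ q a ≢ 0ℚ
    fwd′ a c χ≡0 = onResidues (λ x → Coprime x q → χ q x ≢ 0ℚ) fwd a
                     (coprime-% a c) (trans (χ-% a) χ≡0)

    bwd′ : ∀ a → χ q a ≢ 0ℚ → Coprime a q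
    bwd′ a χ≢0 = coprime-%⁻¹ a (onResidues (λ x → χ q x ≢ 0ℚ → Coprime x q) bwd a
                   (χ≢0 ∘ trans (sym (χ-% a))))

    character : IsDirichletCharacter q (χ q)
    character = record
      { periodic       = λ a → χ-mod q (a ℕ.+ q) a ([m+n]%n≡m%n a q)
      ; multiplicative = λ a b → begin
          χ q (a ℕ.* b)                  ≡⟨ χ-mod q (a ℕ.* b) _ (%-distribˡ-* a b q) ⟩
          χ q (a % q ℕ.* (b % q))        ≡⟨ onResidues (λ x → χ q (x ℕ.* (b % q)) ≡ χ q x * χ q (b % q))
                                              (λ i → onResidues (λ y → χ q (toℕ i ℕ.* y) ≡ χ q (toℕ i) * χ q y)
                                                       (mult i) b) a ⟩
          χ q (a % q) * χ q (b % q)      ≡⟨ cong₂ _*_ (χ-% a) (χ-% b) ⟩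
          χ q a * χ q b                  ∎
      ; unital         = unit
      ; support        = λ a → mk⇔ (fwd′ a) (bwd′ a)
      }
      where open ≡-Reasoning

  mult? : ∀ q .{{_ : NonZero q}} →
          Dec (∀ (i j : Fin q) → χ q (toℕ i ℕ.* toℕ j) ≡ χ q (toℕ i) * χ q (toℕ j))
  mult? q = all? λ i → all? λ j → χ q (toℕ i ℕ.* toℕ j) ℚₚ.≟ χ q (toℕ i) * χ q (toℕ j)

  fwd? : ∀ q .{{_ : NonZero q}} → Dec (∀ (i : Fin q) → Coprime (toℕ i) q → χ q (toℕ i) ≢ 0ℚ)
  fwd? q = all? λ i → coprime? (toℕ i) q →-dec ¬? (χ q (toℕ i) ℚₚ.≟ 0ℚ)

  bwd? : ∀ q .{{_ : NonZero q}} → Dec (∀ (i : Fin q) → χ q (toℕ i) ≢ 0ℚ → Coprime (toℕ i) q)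
  bwd? q = all? λ i → ¬? (χ q (toℕ i) ℚₚ.≟ 0ℚ) →-dec coprime? (toℕ i) q

χ-isDirichletCharacter : ∀ q .{{_ : NonZero q}} → q ≡ 3 ⊎ q ≡ 4 ⊎ q ≡ 6 →
                         IsDirichletCharacter q (χ q)
χ-isDirichletCharacter q (inj₁ refl) = character 3
  (toWitness {a? = mult? 3} _) (toWitness {a? = fwd? 3} _) (toWitness {a? = bwd? 3} _) refl
χ-isDirichletCharacter q (inj₂ (inj₁ refl)) = character 4
  (toWitness {a? = mult? 4} _) (toWitness {a? = fwd? 4} _) (toWitness {a? = bwd? 4} _) refl
χ-isDirichletCharacter q (inj₂ (inj₂ refl)) = character 6
  (toWitness {a? = mult? 6} _) (toWitness {a? = fwd? 6} _) (toWitness {a? = bwd? 6} _) refl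

-- View a sequence B as the linear form x^n ↦ B n on polynomials.  For the
-- generalized Bernoulli numbers the generating function says that
-- B(p(x + q)) - B(p(x)) = p'(1) - p'(q - 1), so B is evaluated by telescoping:
-- with Φ k = ∏_{1≤j≤k} (x² - (1 - qj)²) and Ψ l = ∏_{0≤j<l} (x² - (1 + qj)²),
-- the polynomial x Φ k Ψ l is a difference p(x + q) - p(x) up to the factor
-- 2q(k + l + 1), and p' at 1 splits into a factor depending on k and one
-- depending on l.  Thus in the bases Φ k, Ψ l the Hankel matrix of the odd
-- moments is a Hilbert matrix with rescaled rows and columns, which explicit
-- column operations make triangular.  The even moments vanish, so on all
-- moments the same operations give 2 × 2 antidiagonal blocks.

module Submission where

open import Algebra.Bundles using (CommutativeRing)
open import Data.Fin.Base using (Fin; zero; suc; toℕ; punchIn)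
open import Data.Fin.Properties using (toℕ≤pred[n])
open import Data.Integer.Base as ℤ using (ℤ)
import Data.Integer.Properties as ℤₚ
open import Data.List.Base using (List; []; _∷_; _++_; [_]; applyUpTo; tabulate)
open import Data.List.Properties using (++-assoc; ++-identityʳ; applyUpTo-∷ʳ)
open import Data.List.Relation.Unary.All using (All; []; _∷_)
open import Data.List.Relation.Unary.All.Properties using (applyUpTo⁺₂)
open import Data.Nat.Base as ℕ using (ℕ; zero; suc; NonZero; _∸_; _!; _<_; s≤s)
import Data.Nat.Properties as ℕₚ
open import Data.Product.Base using (_×_; _,_; ∃; ∃₂)
open import Data.Rational.Base as ℚ
  using (ℚ; 0ℚ; 1ℚ; ½; _+_; _*_; _-_; -_; _/_; 1/_; toℚᵘ; +-*-rawSemiring)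
import Data.Rational.Properties as ℚₚ
open import Data.Rational.Unnormalised.Base as ℚᵘ using (mkℚᵘ; *≡*)
import Data.Rational.Unnormalised.Properties as ℚᵘₚ
open import Data.Sum.Base using (_⊎_; inj₁; inj₂)
open import Algebra.Definitions.RawSemiring +-*-rawSemiring using (_^_; sum; product)
open import Algebra.Properties.CommutativeMonoid.Sum ℚₚ.+-0-commutativeMonoid
  using () renaming (sum-cong-≗ to sum-cong; ∑-distrib-+ to sum-+)
open import Algebra.Properties.CommutativeMonoid.Sum ℚₚ.*-1-commutativeMonoid
  using () renaming (sum-cong-≗ to product-cong; ∑-distrib-+ to product-*)
open import Algebra.Properties.CommutativeSemiring.Exp
  (CommutativeRing.commutativeSemiring ℚₚ.+-*-commutativeRing) using (^-distrib-*; ^-assocʳ)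
open import Algebra.Properties.Semiring.Sum
  (CommutativeRing.semiring ℚₚ.+-*-commutativeRing) using (*-distribˡ-sum)
open import Function.Base using (_∘_)
open import Level using (0ℓ)
open import Relation.Binary.PropositionalEquality hiding ([_]; resp)
open import Relation.Nullary.Decidable using (dec⇒maybe)
open import Tactic.RingSolver using (solve-∀)
open import Tactic.RingSolver.Core.AlmostCommutativeRing using (AlmostCommutativeRing; fromCommutativeRing)
open import Defs

-- Differencing a plain power of x mixes all lower powers, so ordinary moments give no usable
-- recursion. The bases come from asking for polynomials G with two properties: G(x) and G(x + q)
-- agree in all but two linear factors, so that their difference is again a product, and G vanishes
-- at 1 and at q - 1, so that each derivative there is a value of the cofactor and hence a product
-- too. Roots in progressions of step q through 1 and through q - 1, exchanged by x ↦ q - x, achieve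
-- both. The price is that rows and columns need different bases. Only the columns of the
-- determinant are changed: the first n of the Φ k span the same even polynomials as 1, x², ...,
-- x^(2n-2), so orthogonality of a column to x Φ k for all k < n already says that its first n
-- odd-indexed entries vanish. The characters enter through Σ χ(a) e^{at} = e^t - e^{(q-1)t}; the
-- elimination itself works for any nonzero rational Q, which treats the three moduli at once.

ℚ-ring : AlmostCommutativeRing 0ℓ 0ℓ
ℚ-ring = fromCommutativeRing ℚₚ.+-*-commutativeRing λ x → dec⇒maybe (0ℚ ℚₚ.≟ x)

-- Integers inside the rationals, and cancellation.

fromℤ : ℤ → ℚ
fromℤ i = i / 1

toℚᵘ-fromℤ : ∀ i → toℚᵘ (fromℤ i) ℚᵘ.≃ mkℚᵘ i 0
toℚᵘ-fromℤ i = ℚₚ.toℚᵘ-fromℚᵘ (mkℚᵘ i 0)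

fromℤ-+ : ∀ i j → fromℤ (i ℤ.+ j) ≡ fromℤ i + fromℤ j
fromℤ-+ i j = ℚₚ.toℚᵘ-injective (begin
  toℚᵘ (fromℤ (i ℤ.+ j))              ≈⟨ toℚᵘ-fromℤ (i ℤ.+ j) ⟩
  mkℚᵘ (i ℤ.+ j) 0                    ≈⟨ *≡* (cong (ℤ._* ℤ.+ 1) (sym (cong₂ ℤ._+_ (ℤₚ.*-identityʳ i) (ℤₚ.*-identityʳ j)))) ⟩
  mkℚᵘ i 0 ℚᵘ.+ mkℚᵘ j 0              ≈⟨ ℚᵘₚ.+-cong (toℚᵘ-fromℤ i) (toℚᵘ-fromℤ j) ⟨
  toℚᵘ (fromℤ i) ℚᵘ.+ toℚᵘ (fromℤ j)  ≈⟨ ℚₚ.toℚᵘ-homo-+ (fromℤ i) (fromℤ j) ⟨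
  toℚᵘ (fromℤ i + fromℤ j)            ∎)
  where open ℚᵘₚ.≃-Reasoning

fromℤ-* : ∀ i j → fromℤ (i ℤ.* j) ≡ fromℤ i * fromℤ j
fromℤ-* i j = ℚₚ.toℚᵘ-injective (begin
  toℚᵘ (fromℤ (i ℤ.* j))              ≈⟨ toℚᵘ-fromℤ (i ℤ.* j) ⟩
  mkℚᵘ i 0 ℚᵘ.* mkℚᵘ j 0              ≈⟨ ℚᵘₚ.*-cong (toℚᵘ-fromℤ i) (toℚᵘ-fromℤ j) ⟨
  toℚᵘ (fromℤ i) ℚᵘ.* toℚᵘ (fromℤ j)  ≈⟨ ℚₚ.toℚᵘ-homo-* (fromℤ i) (fromℤ j) ⟨
  toℚᵘ (fromℤ i * fromℤ j)            ∎)
  where open ℚᵘₚ.≃-Reasoning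

fromℤ-- : ∀ i j → fromℤ (i ℤ.- j) ≡ fromℤ i - fromℤ j
fromℤ-- i j = begin
  fromℤ (i ℤ.- j)                      ≡⟨ lemma (fromℤ (i ℤ.- j)) (fromℤ j) ⟩
  fromℤ (i ℤ.- j) + fromℤ j - fromℤ j  ≡⟨ cong (_- fromℤ j) (fromℤ-+ (i ℤ.- j) j) ⟨
  fromℤ (i ℤ.- j ℤ.+ j) - fromℤ j      ≡⟨ cong (λ k → fromℤ k - fromℤ j) (trans (ℤₚ.+-assoc i (ℤ.- j) j)
                                            (trans (cong (λ k → i ℤ.+ k) (ℤₚ.+-inverseˡ j)) (ℤₚ.+-identityʳ i))) ⟩
  fromℤ i - fromℤ j                    ∎
  where
  open ≡-Reasoning
  lemma : ∀ x y → x ≡ x + y - y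
  lemma = solve-∀ ℚ-ring

fromℕ-+ : ∀ m n → fromℕ (m ℕ.+ n) ≡ fromℕ m + fromℕ n
fromℕ-+ m n = fromℤ-+ (ℤ.+ m) (ℤ.+ n)

fromℕ-* : ∀ m n → fromℕ (m ℕ.* n) ≡ fromℕ m * fromℕ n
fromℕ-* m n = trans (cong fromℤ (ℤₚ.pos-* m n)) (fromℤ-* (ℤ.+ m) (ℤ.+ n))

fromℕ-suc : ∀ n → fromℕ (suc n) ≡ 1ℚ + fromℕ n
fromℕ-suc n = fromℕ-+ 1 n

/-fromℕ : ∀ i d .{{_ : NonZero d}} → (i / d) * fromℕ d ≡ fromℤ i
/-fromℕ i d@(suc d-1) = ℚₚ.toℚᵘ-injective (begin
  toℚᵘ ((i / d) * fromℕ d)          ≈⟨ ℚₚ.toℚᵘ-homo-* (i / d) (fromℕ d) ⟩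
  toℚᵘ (i / d) ℚᵘ.* toℚᵘ (fromℕ d)  ≈⟨ ℚᵘₚ.*-cong (ℚₚ.toℚᵘ-fromℚᵘ (mkℚᵘ i d-1)) (toℚᵘ-fromℤ (ℤ.+ d)) ⟩
  mkℚᵘ i d-1 ℚᵘ.* mkℚᵘ (ℤ.+ d) 0      ≈⟨ *≡* (ℤₚ.*-assoc i (ℤ.+ d) (ℤ.+ 1)) ⟩
  mkℚᵘ i 0                          ≈⟨ toℚᵘ-fromℤ i ⟨
  toℚᵘ (fromℤ i)                    ∎)
  where open ℚᵘₚ.≃-Reasoning

fromℕ-suc≢0 : ∀ n → fromℕ (suc n) ≢ 0ℚ
fromℕ-suc≢0 n e = ℚₚ.<-irrefl (sym e) (ℚₚ.positive⁻¹ (fromℕ (suc n)) {{ℚₚ.normalize-pos (suc n) 1}})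

fromℕ≢0 : ∀ n .{{_ : NonZero n}} → fromℕ n ≢ 0ℚ
fromℕ≢0 (suc n) = fromℕ-suc≢0 n

*-cancelʳ : ∀ {x y} z → z ≢ 0ℚ → x * z ≡ y * z → x ≡ y
*-cancelʳ {x} {y} z z≢0 e = begin
  x               ≡⟨ expand x ⟩
  x * z * 1/ z    ≡⟨ cong (_* 1/ z) e ⟩
  y * z * 1/ z    ≡⟨ expand y ⟨
  y               ∎
  where
  open ≡-Reasoning
  instance _ = ℚ.≢-nonZero z≢0
  expand : ∀ w → w ≡ w * z * 1/ z
  expand w = sym (trans (ℚₚ.*-assoc w z (1/ z)) (trans (cong (w *_) (ℚₚ.*-inverseʳ z)) (ℚₚ.*-identityʳ w)))

*-≢0 : ∀ {x y} → x ≢ 0ℚ → y ≢ 0ℚ → x * y ≢ 0ℚ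
*-≢0 {x} {y} x≢0 y≢0 e = x≢0 (*-cancelʳ y y≢0 (trans e (sym (ℚₚ.*-zeroˡ y))))

-- Determinants as alternating multilinear functions of a list of columns.

infixl 6 _⊕_
infixl 7 _⊙_
_⊕_ : Series → Series → Series
(f ⊕ g) n = f n + g n

_⊙_ : ℚ → Series → Series
(k ⊙ f) n = k * f n

-- Column j of the Hankel matrix of `c`; on linear forms this is multiplication of the argument by
-- x^j.
shift : ℕ → Series → Series
shift j c i = c (i ℕ.+ j)

det-cong : ∀ {n} {M N : Matrix n} → (∀ i j → M i j ≡ N i j) → det M ≡ det N
det-cong {zero}  e = refl
det-cong {suc n} e = sum-cong {suc n} λ j →
  cong₂ _*_ (cong ((- 1ℚ) ^ toℕ j *_) (e zero j)) (det-cong λ i k → e (suc i) (punchIn j k))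

-- Contraction of v₁ ∧ … ∧ vₙ with the linear form φ, followed by f.
contract : (List Series → ℚ) → (Series → ℚ) → List Series → ℚ
contract f φ []       = 0ℚ
contract f φ (v ∷ vs) = φ v * f vs - contract (λ ws → f (v ∷ ws)) φ vs

-- The determinant with rows r, …, r + n - 1 of the listed columns; it
-- vanishes unless there are exactly n columns.
detCols : ℕ → ℕ → List Series → ℚ
detCols zero    r []      = 1ℚ
detCols zero    r (_ ∷ _) = 0ℚ
detCols (suc n) r vs      = contract (detCols n (suc r)) (λ v → v r) vs

contract-cong : ∀ {f g} φ vs → (∀ ws → f ws ≡ g ws) → contract f φ vs ≡ contract g φ vs
contract-cong φ []       e = refl
contract-cong φ (v ∷ vs) e = cong₂ (λ x y → φ v * x - y) (e vs) (contract-cong φ vs (λ ws → e (v ∷ ws)))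

-- Each column passed over by `contract` contributes one subtraction, and these nested subtractions
-- accumulate to the cofactor sign.
contract-tabulate : ∀ {n} f φ (v : Fin (suc n) → Series) →
  contract f φ (tabulate v) ≡ sum (λ j → (- 1ℚ) ^ toℕ j * φ (v j) * f (tabulate (v ∘ punchIn j)))
contract-tabulate {n} f φ v = begin
  φ (v zero) * F₀ - contract f₀ φ (tabulate (v ∘ suc))
    ≡⟨ cong (λ x → φ (v zero) * F₀ - x) (rest n v) ⟩
  φ (v zero) * F₀ - sum (λ j → (- 1ℚ) ^ toℕ j * φ (v (suc j)) * F j)
    ≡⟨ cong₂ _+_ (lemma₁ (φ (v zero)) F₀) (sum-neg (λ j → (- 1ℚ) ^ toℕ j * φ (v (suc j)) * F j)) ⟩
  1ℚ * φ (v zero) * F₀ + sum (λ j → - ((- 1ℚ) ^ toℕ j * φ (v (suc j)) * F j))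
    ≡⟨ cong (1ℚ * φ (v zero) * F₀ +_) (sum-cong λ j → lemma₂ ((- 1ℚ) ^ toℕ j) (φ (v (suc j))) (F j)) ⟩
  sum (λ j → (- 1ℚ) ^ toℕ j * φ (v j) * f (tabulate (v ∘ punchIn j))) ∎
  where
  open ≡-Reasoning
  f₀ = λ ws → f (v zero ∷ ws)
  F₀ = f (tabulate (v ∘ suc))
  F : Fin n → ℚ
  F j = f (tabulate (v ∘ punchIn (suc j)))
  lemma₁ : ∀ x y → x * y ≡ 1ℚ * x * y
  lemma₁ = solve-∀ ℚ-ring
  lemma₂ : ∀ s x y → - (s * x * y) ≡ - 1ℚ * s * x * y
  lemma₂ = solve-∀ ℚ-ring
  lemma₃ : ∀ x y → - (x + y) ≡ - x + - y
  lemma₃ = solve-∀ ℚ-ring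
  sum-neg : ∀ {n} (g : Fin n → ℚ) → - sum g ≡ sum (λ j → - g j)
  sum-neg {zero}  g = refl
  sum-neg {suc n} g = trans (lemma₃ (g zero) (sum (g ∘ suc))) (cong (- g zero +_) (sum-neg (g ∘ suc)))
  rest : ∀ n (v : Fin (suc n) → Series) → contract (λ ws → f (v zero ∷ ws)) φ (tabulate (v ∘ suc))
       ≡ sum (λ j → (- 1ℚ) ^ toℕ j * φ (v (suc j)) * f (tabulate (v ∘ punchIn (suc j))))
  rest zero    v = refl
  rest (suc n) v = contract-tabulate {n} (λ ws → f (v zero ∷ ws)) φ (v ∘ suc)

-- Deleting the top row of the matrix raises the offset `r` by one, so the columns remain infinite
-- sequences and are never truncated.
det-detCols : ∀ n r (v : Fin n → Series) → det (λ i j → v j (r ℕ.+ toℕ i)) ≡ detCols n r (tabulate v)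
det-detCols zero    r v = refl
det-detCols (suc n) r v = sym (trans (contract-tabulate (detCols n (suc r)) (λ w → w r) v)
  (sum-cong λ j → cong₂ _*_
    (cong (λ i → (- 1ℚ) ^ toℕ j * v j i) (sym (ℕₚ.+-identityʳ r)))
    (trans (sym (det-detCols n (suc r) (v ∘ punchIn j)))
           (det-cong λ i k → cong (v (punchIn j k)) (sym (ℕₚ.+-suc r (toℕ i)))))))

tabulate-toℕ : ∀ {A : Set} n (f : ℕ → A) → tabulate {n = n} (f ∘ toℕ) ≡ applyUpTo f n
tabulate-toℕ zero    f = refl
tabulate-toℕ (suc n) f = cong (f 0 ∷_) (tabulate-toℕ n (f ∘ suc))

H-detCols : ∀ n c → H n c ≡ detCols (suc n) 0 (applyUpTo (λ j → shift j c) (suc n))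
H-detCols n c = trans (det-detCols (suc n) 0 (λ j → shift (toℕ j) c))
                      (cong (detCols (suc n) 0) (tabulate-toℕ (suc n) (λ j → shift j c)))

-- Columns are functions compared pointwise, so compatibility with `≗` is a property in its own
-- right. The prefix `xs` makes all three properties stable under fixing a first column, which is
-- what the recursion of `contract` does.
Extensional Linear Alternating : (List Series → ℚ) → Set
Extensional f = ∀ xs {a b} ys → a ≗ b → f (xs ++ a ∷ ys) ≡ f (xs ++ b ∷ ys)
Linear      f = ∀ xs a k b ys → f (xs ++ (a ⊕ k ⊙ b) ∷ ys) ≡ f (xs ++ a ∷ ys) + k * f (xs ++ b ∷ ys)
Alternating f = ∀ xs a ys → f (xs ++ a ∷ a ∷ ys) ≡ 0ℚ

module _ (φ : Series → ℚ) where

  contract-zero : ∀ {f} vs → (∀ ws → f ws ≡ 0ℚ) → contract f φ vs ≡ 0ℚ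
  contract-zero []       e = refl
  contract-zero (v ∷ vs) e = trans (cong₂ (λ x y → φ v * x - y) (e vs) (contract-zero vs (λ ws → e (v ∷ ws))))
                                   (trans (ℚₚ.+-identityʳ _) (ℚₚ.*-zeroʳ (φ v)))

  contract-combine : ∀ f k g vs → contract (λ ws → f ws + k * g ws) φ vs ≡ contract f φ vs + k * contract g φ vs
  contract-combine f k g []       = sym (trans (ℚₚ.+-identityˡ _) (ℚₚ.*-zeroʳ k))
  contract-combine f k g (v ∷ vs) = trans
    (cong (λ x → φ v * (f vs + k * g vs) - x) (contract-combine (f ∘ (v ∷_)) k (g ∘ (v ∷_)) vs))
    (lemma (φ v) (f vs) (g vs) k _ _)
    where
    lemma : ∀ p x y k s t → p * (x + k * y) - (s + k * t) ≡ p * x - s + k * (p * y - t)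
    lemma = solve-∀ ℚ-ring

  contract-extensional : ∀ {f} → (∀ {a b} → a ≗ b → φ a ≡ φ b) → Extensional f → Extensional (contract f φ)
  contract-extensional {f} φ-cong ext []       ys e =
    cong₂ (λ p x → p * f ys - x) (φ-cong e) (contract-cong φ ys λ ws → ext [] ws e)
  contract-extensional φ-cong ext (x ∷ xs) ys e =
    cong₂ (λ p q → φ x * p - q) (ext xs ys e) (contract-extensional φ-cong (λ xs′ → ext (x ∷ xs′)) xs ys e)

  contract-linear : ∀ {f} → (∀ a k b → φ (a ⊕ k ⊙ b) ≡ φ a + k * φ b) → Linear f → Linear (contract f φ)
  contract-linear {f} φ-lin lin []       a k b ys = trans
    (cong₂ (λ p x → p * f ys - x) (φ-lin a k b)
      (trans (contract-cong φ ys λ ws → lin [] a k b ws)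
             (contract-combine (λ ws → f (a ∷ ws)) k (λ ws → f (b ∷ ws)) ys)))
    (lemma (φ a) (φ b) k (f ys) _ _)
    where
    lemma : ∀ p q k x s t → (p + k * q) * x - (s + k * t) ≡ p * x - s + k * (q * x - t)
    lemma = solve-∀ ℚ-ring
  contract-linear {f} φ-lin lin (x ∷ xs) a k b ys = trans
    (cong₂ (λ p q → φ x * p - q) (lin xs a k b ys) (contract-linear φ-lin (λ xs′ → lin (x ∷ xs′)) xs a k b ys))
    (lemma (φ x) k _ _ _ _)
    where
    lemma : ∀ p k x y s t → p * (x + k * y) - (s + k * t) ≡ p * x - s + k * (p * y - t)
    lemma = solve-∀ ℚ-ring

  -- Contracting the first or the second of two equal neighbours gives the same term with opposite
  -- signs; every other term still contains both copies.
  contract-alternating : ∀ {f} → Alternating f → Alternating (contract f φ)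
  contract-alternating {f} alt []       a ys = trans
    (cong (λ x → φ a * f (a ∷ ys) - (φ a * f (a ∷ ys) - x)) (contract-zero ys λ ws → alt [] a ws))
    (lemma (φ a * f (a ∷ ys)))
    where
    lemma : ∀ x → x - (x - 0ℚ) ≡ 0ℚ
    lemma = solve-∀ ℚ-ring
  contract-alternating {f} alt (x ∷ xs) a ys = trans
    (cong₂ (λ p q → φ x * p - q) (alt xs a ys) (contract-alternating (λ xs′ → alt (x ∷ xs′)) xs a ys))
    (lemma (φ x))
    where
    lemma : ∀ x → x * 0ℚ - 0ℚ ≡ 0ℚ
    lemma = solve-∀ ℚ-ring

detCols-extensional : ∀ n r → Extensional (detCols n r)
detCols-extensional zero    r []      ys e = refl
detCols-extensional zero    r (_ ∷ _) ys e = refl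
detCols-extensional (suc n) r = contract-extensional (λ v → v r) (λ e → e r) (detCols-extensional n (suc r))

detCols-linear : ∀ n r → Linear (detCols n r)
detCols-linear zero    r []      a k b ys = sym (trans (ℚₚ.+-identityˡ _) (ℚₚ.*-zeroʳ k))
detCols-linear zero    r (_ ∷ _) a k b ys = sym (trans (ℚₚ.+-identityˡ _) (ℚₚ.*-zeroʳ k))
detCols-linear (suc n) r = contract-linear (λ v → v r) (λ _ _ _ → refl) (detCols-linear n (suc r))

detCols-alternating : ∀ n r → Alternating (detCols n r)
detCols-alternating zero    r []      a ys = refl
detCols-alternating zero    r (_ ∷ _) a ys = refl
detCols-alternating (suc n) r = contract-alternating (λ v → v r) (detCols-alternating n (suc r))

module _ (f : List Series → ℚ) (ext : Extensional f) (lin : Linear f) (alt : Alternating f) where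

  -- Polarization: with a + b in both places the form vanishes, and its expansion leaves just the
  -- two mixed terms.
  swap : ∀ xs a b ys → f (xs ++ a ∷ b ∷ ys) ≡ - f (xs ++ b ∷ a ∷ ys)
  swap xs a b ys = begin
    f (xs ++ a ∷ b ∷ ys)
      ≡⟨ lemma _ _ ⟩
    0ℚ + 1ℚ * f (xs ++ a ∷ b ∷ ys) + 1ℚ * (f (xs ++ b ∷ a ∷ ys) + 1ℚ * 0ℚ) - f (xs ++ b ∷ a ∷ ys)
      ≡⟨ cong (_- f (xs ++ b ∷ a ∷ ys)) (trans total (alt xs (a ⊕ 1ℚ ⊙ b) ys)) ⟩
    0ℚ - f (xs ++ b ∷ a ∷ ys)
      ≡⟨ ℚₚ.+-identityˡ _ ⟩
    - f (xs ++ b ∷ a ∷ ys) ∎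
    where
    open ≡-Reasoning
    lemma : ∀ x y → x ≡ 0ℚ + 1ℚ * x + 1ℚ * (y + 1ℚ * 0ℚ) - y
    lemma = solve-∀ ℚ-ring
    s = a ⊕ 1ℚ ⊙ b
    second : ∀ x → f (xs ++ x ∷ s ∷ ys) ≡ f (xs ++ x ∷ a ∷ ys) + 1ℚ * f (xs ++ x ∷ b ∷ ys)
    second x = subst₂ _≡_ (cong f (++-assoc xs (x ∷ []) _))
      (cong₂ (λ p q → f p + 1ℚ * f q) (++-assoc xs (x ∷ []) _) (++-assoc xs (x ∷ []) _))
      (lin (xs ++ x ∷ []) a 1ℚ b ys)
    total : 0ℚ + 1ℚ * f (xs ++ a ∷ b ∷ ys) + 1ℚ * (f (xs ++ b ∷ a ∷ ys) + 1ℚ * 0ℚ) ≡ f (xs ++ s ∷ s ∷ ys)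
    total = begin
      0ℚ + 1ℚ * f (xs ++ a ∷ b ∷ ys) + 1ℚ * (f (xs ++ b ∷ a ∷ ys) + 1ℚ * 0ℚ)
        ≡⟨ cong₂ (λ p q → p + 1ℚ * f (xs ++ a ∷ b ∷ ys) + 1ℚ * (f (xs ++ b ∷ a ∷ ys) + 1ℚ * q))
             (alt xs a ys) (alt xs b ys) ⟨
      f (xs ++ a ∷ a ∷ ys) + 1ℚ * f (xs ++ a ∷ b ∷ ys) + 1ℚ * (f (xs ++ b ∷ a ∷ ys) + 1ℚ * f (xs ++ b ∷ b ∷ ys))
        ≡⟨ cong₂ (λ p q → p + 1ℚ * q) (second a) (second b) ⟨
      f (xs ++ a ∷ s ∷ ys) + 1ℚ * f (xs ++ b ∷ s ∷ ys)
        ≡⟨ lin xs a 1ℚ b (s ∷ ys) ⟨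
      f (xs ++ s ∷ s ∷ ys) ∎

  repeated : ∀ xs a zs ys → f (xs ++ a ∷ zs ++ a ∷ ys) ≡ 0ℚ
  repeated xs a []       ys = alt xs a ys
  repeated xs a (z ∷ zs) ys = begin
    f (xs ++ a ∷ z ∷ zs ++ a ∷ ys)          ≡⟨ swap xs a z (zs ++ a ∷ ys) ⟩
    - f (xs ++ z ∷ a ∷ zs ++ a ∷ ys)        ≡⟨ cong (λ l → - f l) (++-assoc xs (z ∷ []) _) ⟨
    - f ((xs ++ z ∷ []) ++ a ∷ zs ++ a ∷ ys)  ≡⟨ cong -_ (repeated (xs ++ z ∷ []) a zs ys) ⟩
    0ℚ                                       ∎
    where open ≡-Reasoning

-- Monic changes of the columns of a Hankel matrix.

data Span (c : Series) (n : ℕ) : Series → Set where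
  null : ∀ {w} → w ≗ (λ _ → 0ℚ) → Span c n w
  add  : ∀ {u w} j → j < n → ∀ k → Span c n u → w ≗ u ⊕ k ⊙ shift j c → Span c n w

-- With x acting as the shift, this is `c` multiplied by a monic polynomial of degree n, while
-- `Span` allows any polynomial of degree below n.
Monic : Series → ℕ → Series → Set
Monic c n w = ∃ λ u → Span c n u × w ≗ shift n c ⊕ u

Span-resp : ∀ {c n u w} → u ≗ w → Span c n u → Span c n w
Span-resp e (null z)          = null λ i → trans (sym (e i)) (z i)
Span-resp e (add j j<n k s d) = add j j<n k s λ i → trans (sym (e i)) (d i)

Span-mono : ∀ {c m n w} → m ℕ.≤ n → Span c m w → Span c n w
Span-mono m≤n (null z)          = null z
Span-mono m≤n (add j j<m k s d) = add j (ℕₚ.<-≤-trans j<m m≤n) k (Span-mono m≤n s) d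

Span-tail : ∀ {c n w} → Span c n w → Span c (suc n) (tail w)
Span-tail {c} (null z)                    = null (z ∘ suc)
Span-tail {c} (add {u} j j<n k s d) = add (suc j) (s≤s j<n) k (Span-tail s)
  λ i → trans (d (suc i)) (cong (λ x → u (suc i) + k * c x) (sym (ℕₚ.+-suc i j)))

Span-combine : ∀ {c n v w} → Span c n v → ∀ k → Span c n w → Span c n (v ⊕ k ⊙ w)
Span-combine {v = v} s k (null z) = Span-resp
  (λ i → sym (trans (cong (λ x → v i + k * x) (z i)) (trans (cong (v i +_) (ℚₚ.*-zeroʳ k)) (ℚₚ.+-identityʳ (v i))))) s
Span-combine {c} {v = v} s k (add {u} j j<n l t d) = add j j<n (k * l) (Span-combine s k t)
  λ i → trans (cong (λ x → v i + k * x) (d i)) (lemma (v i) k (u i) l (c (i ℕ.+ j)))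
  where
  lemma : ∀ v k u l s → v + k * (u + l * s) ≡ v + k * u + k * l * s
  lemma = solve-∀ ℚ-ring

Monic⇒Span : ∀ {c n w} → Monic c n w → Span c (suc n) w
Monic⇒Span {c} {n} (u , s , e) = add n ℕₚ.≤-refl 1ℚ (Span-mono (ℕₚ.n≤1+n n) s)
  λ i → trans (e i) (lemma (c (i ℕ.+ n)) (u i))
  where
  lemma : ∀ x y → x + y ≡ y + 1ℚ * x
  lemma = solve-∀ ℚ-ring

Monic-self : ∀ c → Monic c 0 c
Monic-self c = (λ _ → 0ℚ) , null (λ _ → refl) ,
  λ i → sym (trans (ℚₚ.+-identityʳ _) (cong c (ℕₚ.+-identityʳ i)))

Monic-tail : ∀ {c n w} → Monic c n w → Monic c (suc n) (tail w)
Monic-tail {c} {n} (u , s , e) = tail u , Span-tail s ,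
  λ i → trans (e (suc i)) (cong (λ x → c x + u (suc i)) (sym (ℕₚ.+-suc i n)))

Monic-combine : ∀ {c n v w} → Monic c n v → ∀ k → Span c n w → Monic c n (v ⊕ k ⊙ w)
Monic-combine {c} {n} {w = w} (u , s , e) k t = u ⊕ k ⊙ w , Span-combine s k t ,
  λ i → trans (cong (_+ k * w i) (e i)) (ℚₚ.+-assoc (c (i ℕ.+ n)) (u i) (k * w i))

applyUpTo-split : ∀ {A : Set} (f : ℕ → A) {j n} → j < n → ∃₂ λ xs zs → applyUpTo f n ≡ xs ++ f j ∷ zs
applyUpTo-split f {zero}  {suc n} (s≤s j<n) = [] , _ , refl
applyUpTo-split f {suc j} {suc n} (s≤s j<n) with applyUpTo-split (f ∘ suc) j<n
... | xs , zs , e = f 0 ∷ xs , zs , cong (f 0 ∷_) e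

applyUpTo-++ : ∀ {A : Set} (f : ℕ → A) n ss → applyUpTo f (suc n) ++ ss ≡ applyUpTo f n ++ f n ∷ ss
applyUpTo-++ f n ss = trans (cong (_++ ss) (sym (applyUpTo-∷ʳ f n))) (++-assoc (applyUpTo f n) [ f n ] ss)

module _ (f : List Series → ℚ) (ext : Extensional f) (lin : Linear f) (alt : Alternating f) where

  Span-vanishes : ∀ {c n w} → Span c n w → ∀ ss → f (applyUpTo (λ j → shift j c) n ++ w ∷ ss) ≡ 0ℚ
  Span-vanishes {c} {n} {w} (null z) ss = trans (ext xs ss null≗) (trans (lin xs w (- 1ℚ) w ss) (lemma (f (xs ++ w ∷ ss))))
    where
    xs = applyUpTo (λ j → shift j c) n
    -- Writing the zero column as w - w makes linearity alone yield the value 0.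
    null≗ : w ≗ w ⊕ (- 1ℚ) ⊙ w
    null≗ i rewrite z i = refl
    lemma : ∀ x → x + - 1ℚ * x ≡ 0ℚ
    lemma = solve-∀ ℚ-ring
  Span-vanishes {c} {n} (add {u} j j<n k s d) ss = begin
    f (xs ++ _ ∷ ss)                             ≡⟨ ext xs ss d ⟩
    f (xs ++ (u ⊕ k ⊙ shift j c) ∷ ss)           ≡⟨ lin xs u k (shift j c) ss ⟩
    f (xs ++ u ∷ ss) + k * f (xs ++ shift j c ∷ ss)  ≡⟨ cong₂ (λ x y → x + k * y) (Span-vanishes s ss) repeat ⟩
    0ℚ + k * 0ℚ                                  ≡⟨ trans (ℚₚ.+-identityˡ _) (ℚₚ.*-zeroʳ k) ⟩
    0ℚ                                           ∎
    where
    open ≡-Reasoning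
    xs = applyUpTo (λ j → shift j c) n
    repeat : f (xs ++ shift j c ∷ ss) ≡ 0ℚ
    repeat with applyUpTo-split (λ j → shift j c) j<n
    ... | ys , zs , e = trans (cong (λ l → f (l ++ shift j c ∷ ss)) e)
                          (trans (cong f (++-assoc ys (shift j c ∷ zs) (shift j c ∷ ss)))
                                 (repeated f ext lin alt ys (shift j c) zs ss))

  -- A unitriangular change of columns. The trailing `ss` is arbitrary so that the induction
  -- hypothesis can restore the columns to the left while v n waits behind them; its lower terms are
  -- then combinations of columns already present.
  Monic-replace : ∀ {c v} → (∀ n → Monic c n (v n)) → ∀ n ss →
                  f (applyUpTo v n ++ ss) ≡ f (applyUpTo (λ j → shift j c) n ++ ss)
  Monic-replace monic zero    ss = refl
  Monic-replace {c} {v} monic (suc n) ss with monic n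
  ... | u , s , e = begin
    f (applyUpTo v (suc n) ++ ss)         ≡⟨ cong f (applyUpTo-++ v n ss) ⟩
    f (applyUpTo v n ++ v n ∷ ss)         ≡⟨ Monic-replace monic n (v n ∷ ss) ⟩
    f (xs ++ v n ∷ ss)                    ≡⟨ ext xs ss (λ i → trans (e i) (cong (λ x → c (i ℕ.+ n) + x) (sym (ℚₚ.*-identityˡ (u i))))) ⟩
    f (xs ++ (shift n c ⊕ 1ℚ ⊙ u) ∷ ss)   ≡⟨ lin xs (shift n c) 1ℚ u ss ⟩
    f (xs ++ shift n c ∷ ss) + 1ℚ * f (xs ++ u ∷ ss)
                                          ≡⟨ cong (λ x → f (xs ++ shift n c ∷ ss) + 1ℚ * x) (Span-vanishes s ss) ⟩
    f (xs ++ shift n c ∷ ss) + 1ℚ * 0ℚ    ≡⟨ ℚₚ.+-identityʳ _ ⟩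
    f (xs ++ shift n c ∷ ss)              ≡⟨ cong f (applyUpTo-++ (λ j → shift j c) n ss) ⟨
    f (applyUpTo (λ j → shift j c) (suc n) ++ ss) ∎
    where
    open ≡-Reasoning
    xs = applyUpTo (λ j → shift j c) n

H-Monic : ∀ {c v} → (∀ n → Monic c n (v n)) → ∀ n → H n c ≡ detCols (suc n) 0 (applyUpTo v (suc n))
H-Monic {c} {v} monic n = begin
  H n c                                                     ≡⟨ H-detCols n c ⟩
  f (applyUpTo (λ j → shift j c) (suc n))                   ≡⟨ cong f (++-identityʳ (applyUpTo (λ j → shift j c) (suc n))) ⟨
  f (applyUpTo (λ j → shift j c) (suc n) ++ [])             ≡⟨ Monic-replace f (detCols-extensional (suc n) 0)
                                                                 (detCols-linear (suc n) 0)
                                                                 (detCols-alternating (suc n) 0) monic (suc n) [] ⟨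
  f (applyUpTo v (suc n) ++ [])                             ≡⟨ cong f (++-identityʳ (applyUpTo v (suc n))) ⟩
  f (applyUpTo v (suc n))                                   ∎
  where
  open ≡-Reasoning
  f = detCols (suc n) 0

-- Block triangular determinants with antidiagonal 2 × 2 blocks.

interleave : (ℕ → Series) → ℕ → Series
interleave W zero          = W 0
interleave W (suc zero)    = tail (W 0)
interleave W (suc (suc n)) = interleave (W ∘ suc) n

interleave-All : ∀ (P : ℕ → Series → Set) W → (∀ n → P (n ℕ.* 2) (W n)) → (∀ n → P (suc (n ℕ.* 2)) (tail (W n))) →
                 ∀ n → P n (interleave W n)
interleave-All P W p p′ zero          = p 0
interleave-All P W p p′ (suc zero)    = p′ 0
interleave-All P W p p′ (suc (suc n)) = interleave-All (λ n → P (suc (suc n))) (W ∘ suc) (p ∘ suc) (p′ ∘ suc) n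

contract-All-zero : ∀ f φ {vs} → All (λ v → φ v ≡ 0ℚ) vs → contract f φ vs ≡ 0ℚ
contract-All-zero f φ []                       = refl
contract-All-zero f φ {v ∷ vs} (z ∷ zs) = trans
  (cong₂ (λ x y → x * f vs - y) z (contract-All-zero (f ∘ (v ∷_)) φ zs))
  (trans (ℚₚ.+-identityʳ _) (ℚₚ.*-zeroˡ (f vs)))

-- Below row 2s, the columns W n and tail (W n) form a block triangular
-- array with antidiagonal 2 × 2 diagonal blocks with entries h n.
record Antidiagonal (s : ℕ) (W : ℕ → Series) (h : ℕ → ℚ) : Set where
  field
    even  : ∀ n i → W n (i ℕ.* 2) ≡ 0ℚ
    upper : ∀ n {i} → i < s ℕ.+ n → W n (suc (i ℕ.* 2)) ≡ 0ℚ
    diag  : ∀ n → W n (suc ((s ℕ.+ n) ℕ.* 2)) ≡ h n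

open Antidiagonal

Antidiagonal-suc : ∀ {s W h} → Antidiagonal s W h → Antidiagonal (suc s) (W ∘ suc) (h ∘ suc)
Antidiagonal-suc a .even n i = a .even (suc n) i
Antidiagonal-suc {s} a .upper n {i} i<s+n = a .upper (suc n) (subst (i <_) (sym (ℕₚ.+-suc s n)) i<s+n)
Antidiagonal-suc {s} {W} {h} a .diag n =
  subst (λ x → W (suc n) (suc (x ℕ.* 2)) ≡ h (suc n)) (ℕₚ.+-suc s n) (a .diag (suc n))

module _ {s W h} (a : Antidiagonal s W h) where

  private
    s+0≡s = ℕₚ.+-identityʳ s

    entry : W 0 (suc (s ℕ.* 2)) ≡ h 0
    entry = subst (λ x → W 0 (suc (x ℕ.* 2)) ≡ h 0) s+0≡s (a .diag 0)

    above : ∀ n → W (suc n) (suc (s ℕ.* 2)) ≡ 0ℚ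
    above n = a .upper (suc n) (subst (s <_) (sym (ℕₚ.+-suc s n)) (s≤s (ℕₚ.m≤m+n s n)))

    zeros : ∀ r → (∀ n → W (suc n) r ≡ 0ℚ) → (∀ n → W (suc n) (suc r) ≡ 0ℚ) →
            ∀ N → All (λ v → v r ≡ 0ℚ) (applyUpTo (interleave (W ∘ suc)) N)
    zeros r p p′ N = applyUpTo⁺₂ _ N (interleave-All (λ _ v → v r ≡ 0ℚ) (W ∘ suc) p p′)

  -- Since `tail` exchanges the parities of rows, the zeros of W 0 in even rows leave the block (0
  -- h; h 0) in rows 2s and 2s + 1, of determinant -h². All later columns vanish in these two rows.
  detCols-block : ∀ N → detCols (2 ℕ.+ N) (s ℕ.* 2) (applyUpTo (interleave W) (2 ℕ.+ N))
    ≡ - (h 0 * h 0) * detCols N (suc s ℕ.* 2) (applyUpTo (interleave (W ∘ suc)) N)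
  detCols-block N = begin
    W 0 r * f (tail (W 0) ∷ vs) - (W 0 (suc r) * f (W 0 ∷ vs) - contract (λ ws → f (W 0 ∷ tail (W 0) ∷ ws)) (λ v → v r) vs)
      ≡⟨ cong₂ (λ x y → x * f (tail (W 0) ∷ vs) - (W 0 (suc r) * f (W 0 ∷ vs) - y)) (a .even 0 s)
           (contract-All-zero _ (λ v → v r) (zeros r (λ n → a .even (suc n) s) above N)) ⟩
    0ℚ * f (tail (W 0) ∷ vs) - (W 0 (suc r) * f (W 0 ∷ vs) - 0ℚ)
      ≡⟨ cong (λ x → 0ℚ * f (tail (W 0) ∷ vs) - (W 0 (suc r) * x - 0ℚ))
           (cong (λ y → W 0 (suc r) * detCols N (suc (suc r)) vs - y)
             (contract-All-zero _ (λ v → v (suc r)) (zeros (suc r) above (λ n → a .even (suc n) (suc s)) N))) ⟩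
    0ℚ * f (tail (W 0) ∷ vs) - (W 0 (suc r) * (W 0 (suc r) * detCols N (suc (suc r)) vs - 0ℚ) - 0ℚ)
      ≡⟨ cong (λ x → 0ℚ * f (tail (W 0) ∷ vs) - (x * (x * detCols N (suc (suc r)) vs - 0ℚ) - 0ℚ)) entry ⟩
    0ℚ * f (tail (W 0) ∷ vs) - (h 0 * (h 0 * detCols N (suc (suc r)) vs - 0ℚ) - 0ℚ)
      ≡⟨ lemma (f (tail (W 0) ∷ vs)) (h 0) _ ⟩
    - (h 0 * h 0) * detCols N (suc (suc r)) vs ∎
    where
    open ≡-Reasoning
    r  = s ℕ.* 2
    f  = detCols (suc N) (suc r)
    vs = applyUpTo (interleave (W ∘ suc)) N
    lemma : ∀ x h d → 0ℚ * x - (h * (h * d - 0ℚ) - 0ℚ) ≡ - (h * h) * d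
    lemma = solve-∀ ℚ-ring

detCols-even : ∀ m {s W h} → Antidiagonal s W h →
  detCols (m ℕ.* 2) (s ℕ.* 2) (applyUpTo (interleave W) (m ℕ.* 2)) ≡ product {m} (λ i → - (h (toℕ i) * h (toℕ i)))
detCols-even zero    a = refl
detCols-even (suc m) {h = h} a =
  trans (detCols-block a (m ℕ.* 2)) (cong (- (h 0 * h 0) *_) (detCols-even m (Antidiagonal-suc a)))

-- After m blocks a single column remains, and it is read off in an even row, where it is zero.
detCols-odd : ∀ m {s W h} → Antidiagonal s W h →
  detCols (suc (m ℕ.* 2)) (s ℕ.* 2) (applyUpTo (interleave W) (suc (m ℕ.* 2))) ≡ 0ℚ
detCols-odd zero    {s} a = trans (cong (λ x → x * 1ℚ - 0ℚ) (a .even 0 s)) refl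
detCols-odd (suc m) {h = h} a =
  trans (detCols-block a (suc (m ℕ.* 2)))
        (trans (cong (- (h 0 * h 0) *_) (detCols-odd m (Antidiagonal-suc a))) (ℚₚ.*-zeroʳ (- (h 0 * h 0))))

-- Linear operators on moment sequences and products of linear factors.

record IsLinear (T : Series → Series) : Set where
  field
    resp    : ∀ {c d} → c ≗ d → T c ≗ T d
    combine : ∀ c k d → T (c ⊕ k ⊙ d) ≗ T c ⊕ k ⊙ T d

  scale : ∀ k c → T (k ⊙ c) ≗ k ⊙ T c
  scale k c n = begin
    T (k ⊙ c) n                 ≡⟨ resp (λ i → lemma k (c i)) n ⟩
    T (c ⊕ (k - 1ℚ) ⊙ c) n      ≡⟨ combine c (k - 1ℚ) c n ⟩
    T c n + (k - 1ℚ) * T c n    ≡⟨ lemma k (T c n) ⟨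
    k * T c n                   ∎
    where
    open ≡-Reasoning
    lemma : ∀ k x → k * x ≡ x + (k - 1ℚ) * x
    lemma = solve-∀ ℚ-ring

open IsLinear

∘-isLinear : ∀ {S T} → IsLinear S → IsLinear T → IsLinear (S ∘ T)
∘-isLinear s t .resp e          = s .resp (t .resp e)
∘-isLinear s t .combine c k d n = trans (s .resp (t .combine c k d) n) (s .combine _ k _ n)

-- The linear factor x - r, acting on moment sequences with x acting as the shift.
lin : ℚ → Series → Series
lin r c n = c (suc n) - r * c n

lin-isLinear : ∀ r → IsLinear (lin r)
lin-isLinear r .resp e n          = cong₂ (λ x y → x - r * y) (e (suc n)) (e n)
lin-isLinear r .combine c k d n = lemma (c (suc n)) (d (suc n)) (c n) (d n) k r
  where
  lemma : ∀ x y z w k r → x + k * y - r * (z + k * w) ≡ x - r * z + k * (y - r * w)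
  lemma = solve-∀ ℚ-ring

lin-comm : ∀ r s c → lin r (lin s c) ≗ lin s (lin r c)
lin-comm r s c n = lemma r s (c (suc (suc n))) (c (suc n)) (c n)
  where
  lemma : ∀ r s x y z → x - s * y - r * (y - s * z) ≡ x - r * y - s * (y - r * z)
  lemma = solve-∀ ℚ-ring

lin-± : ∀ r c n → lin r (lin (- r) c) n ≡ c (suc (suc n)) - r * r * c n
lin-± r c n = lemma r (c (suc (suc n))) (c (suc n)) (c n)
  where
  lemma : ∀ r x y z → x - (- r) * y - r * (y - (- r) * z) ≡ x - r * r * z
  lemma = solve-∀ ℚ-ring

-- Multiplication by ∏ (x - s i)(x - t i) over i < l. Two root families are kept apart so that one
-- can be reindexed while the other stays fixed.
Prod : (s t : ℕ → ℚ) → ℕ → Series → Series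
Prod s t zero    c = c
Prod s t (suc l) c = Prod s t l (lin (s l) (lin (t l) c))

Prod-isLinear : ∀ s t l → IsLinear (Prod s t l)
Prod-isLinear s t zero .resp e          = e
Prod-isLinear s t zero .combine c k d n = refl
Prod-isLinear s t (suc l) =
  ∘-isLinear (Prod-isLinear s t l) (∘-isLinear (lin-isLinear (s l)) (lin-isLinear (t l)))

Prod-tail : ∀ s t l c → Prod s t l (tail c) ≗ tail (Prod s t l c)
Prod-tail s t zero    c n = refl
Prod-tail s t (suc l) c n = Prod-tail s t l (lin (s l) (lin (t l) c)) n

Prod-lin : ∀ s t l r c → Prod s t l (lin r c) ≗ lin r (Prod s t l c)
Prod-lin s t zero    r c n = refl
Prod-lin s t (suc l) r c n = begin
  Prod s t l (lin (s l) (lin (t l) (lin r c))) n  ≡⟨ P.resp (S.resp (lin-comm (t l) r c)) n ⟩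
  Prod s t l (lin (s l) (lin r (lin (t l) c))) n  ≡⟨ P.resp (lin-comm (s l) r (lin (t l) c)) n ⟩
  Prod s t l (lin r (lin (s l) (lin (t l) c))) n  ≡⟨ Prod-lin s t l r (lin (s l) (lin (t l) c)) n ⟩
  lin r (Prod s t l (lin (s l) (lin (t l) c))) n  ∎
  where
  open ≡-Reasoning
  module P = IsLinear (Prod-isLinear s t l)
  module S = IsLinear (lin-isLinear (s l))

Prod-swap : ∀ s t l c → Prod s t l c ≗ Prod t s l c
Prod-swap s t zero    c n = refl
Prod-swap s t (suc l) c n =
  trans (Prod-isLinear s t l .resp (lin-comm (s l) (t l) c) n) (Prod-swap s t l (lin (t l) (lin (s l) c)) n)

-- Both sides multiply by the same factors, with roots s 0, ..., s l and t 0, ..., t (l - 1), so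
-- only commutation is involved.
Prod-telescope : ∀ s t l c → Prod (s ∘ suc) t l (lin (s 0) c) ≗ Prod s t l (lin (s l) c)
Prod-telescope s t zero    c n = refl
Prod-telescope s t (suc l) c n = begin
  Prod (s ∘ suc) t l (lin (s (suc l)) (lin (t l) (lin (s 0) c))) n
    ≡⟨ P′.resp (S.resp (lin-comm (t l) (s 0) c)) n ⟩
  Prod (s ∘ suc) t l (lin (s (suc l)) (lin (s 0) (lin (t l) c))) n
    ≡⟨ P′.resp (lin-comm (s (suc l)) (s 0) (lin (t l) c)) n ⟩
  Prod (s ∘ suc) t l (lin (s 0) (lin (s (suc l)) (lin (t l) c))) n
    ≡⟨ Prod-telescope s t l (lin (s (suc l)) (lin (t l) c)) n ⟩
  Prod s t l (lin (s l) (lin (s (suc l)) (lin (t l) c))) n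
    ≡⟨ P.resp (IsLinear.resp (lin-isLinear (s l)) (lin-comm (s (suc l)) (t l) c)) n ⟩
  Prod s t l (lin (s l) (lin (t l) (lin (s (suc l)) c))) n ∎
  where
  open ≡-Reasoning
  module P  = IsLinear (Prod-isLinear s t l)
  module P′ = IsLinear (Prod-isLinear (s ∘ suc) t l)
  module S  = IsLinear (lin-isLinear (s (suc l)))

Prod-telescope₂ : ∀ s t k s′ t′ l c →
  Prod (s ∘ suc) t k (Prod (s′ ∘ suc) t′ l (lin (s′ 0) (lin (s 0) c))) ≗
  Prod s t k (Prod s′ t′ l (lin (s k) (lin (s′ l) c)))
Prod-telescope₂ s t k s′ t′ l c n = begin
  Prod (s ∘ suc) t k (Prod (s′ ∘ suc) t′ l (lin (s′ 0) (lin (s 0) c))) n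
    ≡⟨ P.resp (Prod-telescope s′ t′ l (lin (s 0) c)) n ⟩
  Prod (s ∘ suc) t k (Prod s′ t′ l (lin (s′ l) (lin (s 0) c))) n
    ≡⟨ P.resp (IsLinear.resp (Prod-isLinear s′ t′ l) (lin-comm (s′ l) (s 0) c)) n ⟩
  Prod (s ∘ suc) t k (Prod s′ t′ l (lin (s 0) (lin (s′ l) c))) n
    ≡⟨ P.resp (Prod-lin s′ t′ l (s 0) (lin (s′ l) c)) n ⟩
  Prod (s ∘ suc) t k (lin (s 0) (Prod s′ t′ l (lin (s′ l) c))) n
    ≡⟨ Prod-telescope s t k (Prod s′ t′ l (lin (s′ l) c)) n ⟩
  Prod s t k (lin (s k) (Prod s′ t′ l (lin (s′ l) c))) n
    ≡⟨ IsLinear.resp (Prod-isLinear s t k) (Prod-lin s′ t′ l (s k) (lin (s′ l) c)) n ⟨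
  Prod s t k (Prod s′ t′ l (lin (s k) (lin (s′ l) c))) n ∎
  where
  open ≡-Reasoning
  module P = IsLinear (Prod-isLinear (s ∘ suc) t k)

-- The linear forms p ↦ p(x) and p ↦ p'(x), by their values on monomials.
δ d : ℚ → Series
δ x n = x ^ n
d x zero    = 0ℚ
d x (suc n) = fromℕ (suc n) * x ^ n

lin-δ : ∀ r x → lin r (δ x) ≗ (x - r) ⊙ δ x
lin-δ r x n = lemma r x (x ^ n)
  where
  lemma : ∀ r x y → x * y - r * y ≡ (x - r) * y
  lemma = solve-∀ ℚ-ring

-- The product rule at a zero: the derivative of (X - x) p(X) at x is p(x).
lin-d : ∀ x → lin x (d x) ≗ δ x
lin-d x zero    = lemma x
  where
  lemma : ∀ x → 1ℚ * 1ℚ - x * 0ℚ ≡ 1ℚ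
  lemma = solve-∀ ℚ-ring
lin-d x (suc n) = trans (cong (λ y → y * (x * x ^ n) - x * (fromℕ (suc n) * x ^ n)) (fromℕ-suc (suc n)))
                        (lemma (fromℕ (suc n)) x (x ^ n))
  where
  lemma : ∀ m x y → (1ℚ + m) * (x * y) - x * (m * y) ≡ x * y
  lemma = solve-∀ ℚ-ring

evalProd : (s t : ℕ → ℚ) → ℕ → ℚ → ℚ
evalProd s t zero    x = 1ℚ
evalProd s t (suc l) x = evalProd s t l x * ((x - s l) * (x - t l))

Prod-δ : ∀ s t l x → Prod s t l (δ x) ≗ evalProd s t l x ⊙ δ x
Prod-δ s t zero    x n = sym (ℚₚ.*-identityˡ (x ^ n))
Prod-δ s t (suc l) x n = begin
  Prod s t l (lin (s l) (lin (t l) (δ x))) n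
    ≡⟨ P.resp (IsLinear.resp (lin-isLinear (s l)) (lin-δ (t l) x)) n ⟩
  Prod s t l (lin (s l) ((x - t l) ⊙ δ x)) n
    ≡⟨ P.resp (λ i → trans (scale (lin-isLinear (s l)) (x - t l) (δ x) i) (cong ((x - t l) *_) (lin-δ (s l) x i))) n ⟩
  Prod s t l ((x - t l) ⊙ ((x - s l) ⊙ δ x)) n
    ≡⟨ trans (P.scale (x - t l) _ n) (cong ((x - t l) *_) (P.scale (x - s l) (δ x) n)) ⟩
  (x - t l) * ((x - s l) * Prod s t l (δ x) n)
    ≡⟨ cong (λ y → (x - t l) * ((x - s l) * y)) (Prod-δ s t l x n) ⟩
  (x - t l) * ((x - s l) * (evalProd s t l x * x ^ n))
    ≡⟨ lemma (x - t l) (x - s l) (evalProd s t l x) (x ^ n) ⟩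
  evalProd s t l x * ((x - s l) * (x - t l)) * x ^ n ∎
  where
  open ≡-Reasoning
  module P = IsLinear (Prod-isLinear s t l)
  lemma : ∀ p q e y → p * (q * (e * y)) ≡ e * (q * p) * y
  lemma = solve-∀ ℚ-ring

-- Translation by Q and telescoping polynomials.

module Translation (Q : ℚ) where

  -- (τ c)(p) = c(p(x + Q)) for c viewed as a linear form on polynomials p.
  τ : Series → Series
  τ c zero    = c 0
  τ c (suc n) = τ (tail c ⊕ Q ⊙ c) n

  τ-isLinear : IsLinear τ
  τ-isLinear .resp e zero    = e 0
  τ-isLinear .resp e (suc n) = τ-isLinear .resp (λ i → cong₂ (λ x y → x + Q * y) (e (suc i)) (e i)) n
  τ-isLinear .combine c k d zero    = refl
  τ-isLinear .combine c k d (suc n) = trans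
    (τ-isLinear .resp (λ i → lemma (c (suc i)) (d (suc i)) (c i) (d i) k Q) n)
    (τ-isLinear .combine (tail c ⊕ Q ⊙ c) k (tail d ⊕ Q ⊙ d) n)
    where
    lemma : ∀ x y z w k q → x + k * y + q * (z + k * w) ≡ x + q * z + k * (y + q * w)
    lemma = solve-∀ ℚ-ring

  -- Substituting x + Q turns the factor x - r into x - (r - Q). The new root is passed with an
  -- equation so that it can be one of the named points.
  lin-τ : ∀ r {r′} → r′ ≡ r - Q → ∀ c → lin r (τ c) ≗ τ (lin r′ c)
  lin-τ r refl c n = begin
    τ (tail c ⊕ Q ⊙ c) n - r * τ c n              ≡⟨ lemma₁ (τ (tail c ⊕ Q ⊙ c) n) r (τ c n) ⟩
    τ (tail c ⊕ Q ⊙ c) n + (- r) * τ c n          ≡⟨ τ-isLinear .combine (tail c ⊕ Q ⊙ c) (- r) c n ⟨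
    τ (tail c ⊕ Q ⊙ c ⊕ (- r) ⊙ c) n              ≡⟨ τ-isLinear .resp (λ i → lemma₂ (c (suc i)) (c i) r Q) n ⟩
    τ (lin (r - Q) c) n                           ∎
    where
    open ≡-Reasoning
    lemma₁ : ∀ x r y → x - r * y ≡ x + (- r) * y
    lemma₁ = solve-∀ ℚ-ring
    lemma₂ : ∀ x y r q → x + q * y + (- r) * y ≡ x - (r - q) * y
    lemma₂ = solve-∀ ℚ-ring

  Prod-τ : ∀ {s t s′ t′} → (∀ i → s′ i ≡ s i - Q) → (∀ i → t′ i ≡ t i - Q) →
           ∀ l c → Prod s t l (τ c) ≗ τ (Prod s′ t′ l c)
  Prod-τ e f zero    c n = refl
  Prod-τ {s} {t} {s′} {t′} e f (suc l) c n = begin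
    Prod s t l (lin (s l) (lin (t l) (τ c))) n     ≡⟨ P.resp (IsLinear.resp (lin-isLinear (s l)) (lin-τ (t l) (f l) c)) n ⟩
    Prod s t l (lin (s l) (τ (lin (t′ l) c))) n    ≡⟨ P.resp (lin-τ (s l) (e l) (lin (t′ l) c)) n ⟩
    Prod s t l (τ (lin (s′ l) (lin (t′ l) c))) n   ≡⟨ Prod-τ e f l (lin (s′ l) (lin (t′ l) c)) n ⟩
    τ (Prod s′ t′ l (lin (s′ l) (lin (t′ l) c))) n ∎
    where
    open ≡-Reasoning
    module P = IsLinear (Prod-isLinear s t l)

  -- The points 1 + Qj and -(1 + Qj): a and b for j = i, a⁻ and b⁻ for j = -(i + 1).
  a b a⁻ b⁻ : ℕ → ℚ
  a  i = 1ℚ + Q * fromℕ i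
  b  i = - a i
  a⁻ i = 1ℚ - Q * fromℕ (suc i)
  b⁻ i = - a⁻ i

  Φ Ψ : ℕ → Series → Series
  Φ = Prod a⁻ b⁻
  Ψ = Prod a b

  ΦΨ-isLinear : ∀ k l → IsLinear (Φ k ∘ Ψ l)
  ΦΨ-isLinear k l = ∘-isLinear (Prod-isLinear a⁻ b⁻ k) (Prod-isLinear a b l)

  R C : ℕ → ℚ
  R k = evalProd (b⁻ ∘ suc) a⁻ k (a 0)
  C l = evalProd (a ∘ suc) b l (a 0)

  -- The polynomial G of `telescope` with its zeros 1 = a 0 and Q - 1 = b⁻ 0 divided out; R k * C l
  -- is its value at 1.
  Γ : ℕ → ℕ → Series → Series
  Γ k l = Prod (b⁻ ∘ suc) a⁻ k ∘ Prod (a ∘ suc) b l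

  Γ-isLinear : ∀ k l → IsLinear (Γ k l)
  Γ-isLinear k l = ∘-isLinear (Prod-isLinear (b⁻ ∘ suc) a⁻ k) (Prod-isLinear (a ∘ suc) b l)

  a-suc : ∀ i → a i ≡ a (suc i) - Q
  a-suc i = trans (lemma Q (fromℕ i)) (cong (λ x → 1ℚ + Q * x - Q) (sym (fromℕ-suc i)))
    where
    lemma : ∀ q x → 1ℚ + q * x ≡ 1ℚ + q * (1ℚ + x) - q
    lemma = solve-∀ ℚ-ring

  b-suc : ∀ i → b (suc i) ≡ b i - Q
  b-suc i = trans (cong (λ x → - (1ℚ + Q * x)) (fromℕ-suc i)) (lemma Q (fromℕ i))
    where
    lemma : ∀ q x → - (1ℚ + q * (1ℚ + x)) ≡ - (1ℚ + q * x) - q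
    lemma = solve-∀ ℚ-ring

  a⁻-suc : ∀ i → a⁻ (suc i) ≡ a⁻ i - Q
  a⁻-suc i = trans (cong (λ x → 1ℚ - Q * x) (fromℕ-suc (suc i))) (lemma Q (fromℕ (suc i)))
    where
    lemma : ∀ q x → 1ℚ - q * (1ℚ + x) ≡ 1ℚ - q * x - q
    lemma = solve-∀ ℚ-ring

  b⁻-suc : ∀ i → b⁻ i ≡ b⁻ (suc i) - Q
  b⁻-suc i = trans (lemma Q (fromℕ (suc i))) (cong (λ x → - (1ℚ - Q * x) - Q) (sym (fromℕ-suc (suc i))))
    where
    lemma : ∀ q x → - (1ℚ - q * x) ≡ - (1ℚ - q * (1ℚ + x)) - q
    lemma = solve-∀ ℚ-ring

  -- Here translation crosses between the families: a 0 moves into the negative points, and in `b-0`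
  -- the point b⁻ 0 moves into the nonnegative ones.
  a⁻-0 : a⁻ 0 ≡ a 0 - Q
  a⁻-0 = lemma Q
    where
    lemma : ∀ q → 1ℚ - q * 1ℚ ≡ 1ℚ + q * 0ℚ - q
    lemma = solve-∀ ℚ-ring

  b-0 : b 0 ≡ b⁻ 0 - Q
  b-0 = lemma Q
    where
    lemma : ∀ q → - (1ℚ + q * 0ℚ) ≡ - (1ℚ - q * 1ℚ) - q
    lemma = solve-∀ ℚ-ring

  -- With G = ∏_{-k≤j≤l} (x - 1 - Qj)(x + 1 + Q(j-1)), both G(x) and G(x + Q) are
  -- Φ k Ψ l times a quadratic factor, and G commutes past τ up to x ↦ x + Q.
  telescope : ∀ k l c e D → τ c ≗ e ⊕ D →
    Φ k (Ψ l (lin (a⁻ k) (lin (b l) c))) 0 ≡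
    Φ k (Ψ l (lin (b⁻ k) (lin (a l) e))) 0 + Γ k l (lin (a 0) (lin (b⁻ 0) D)) 0
  telescope k l c e D τc = begin
    Φ k (Ψ l (lin (a⁻ k) (lin (b l) c))) 0
      ≡⟨ Prod-isLinear a⁻ b⁻ k .resp (Prod-swap a b l _) 0 ⟩
    Prod a⁻ b⁻ k (Prod b a l (lin (a⁻ k) (lin (b l) c))) 0
      ≡⟨ Prod-telescope₂ a⁻ b⁻ k b a l c 0 ⟨
    Prod (a⁻ ∘ suc) b⁻ k (Prod (b ∘ suc) a l (lin (b 0) (lin (a⁻ 0) c))) 0
      ≡⟨ Prod-swap (a⁻ ∘ suc) b⁻ k _ 0 ⟩
    Prod b⁻ (a⁻ ∘ suc) k (Prod (b ∘ suc) a l (lin (b 0) (lin (a⁻ 0) c))) 0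
      ≡⟨ Prod-isLinear b⁻ (a⁻ ∘ suc) k .resp (λ n → trans (Prod-swap (b ∘ suc) a l _ n)
           (Prod-isLinear a (b ∘ suc) l .resp (lin-comm (b 0) (a⁻ 0) c) n)) 0 ⟩
    τ (Prod b⁻ (a⁻ ∘ suc) k (Prod a (b ∘ suc) l (lin (a⁻ 0) (lin (b 0) c)))) 0
      ≡⟨ Prod-τ b⁻-suc a⁻-suc k _ 0 ⟨
    Prod (b⁻ ∘ suc) a⁻ k (τ (Prod a (b ∘ suc) l (lin (a⁻ 0) (lin (b 0) c)))) 0
      ≡⟨ Prod-isLinear (b⁻ ∘ suc) a⁻ k .resp (Prod-τ a-suc b-suc l _) 0 ⟨
    Γ k l (τ (lin (a⁻ 0) (lin (b 0) c))) 0
      ≡⟨ Γ-isLinear k l .resp (λ n → trans (IsLinear.resp (lin-isLinear (a 0)) (lin-τ (b⁻ 0) b-0 c) n) (lin-τ (a 0) a⁻-0 (lin (b 0) c) n)) 0 ⟨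
    Γ k l (lin (a 0) (lin (b⁻ 0) (τ c))) 0
      ≡⟨ G .resp (λ n → trans (τc n) (cong (e n +_) (sym (ℚₚ.*-identityˡ (D n))))) 0 ⟩
    Γ k l (lin (a 0) (lin (b⁻ 0) (e ⊕ 1ℚ ⊙ D))) 0
      ≡⟨ G .combine e 1ℚ D 0 ⟩
    Γ k l (lin (a 0) (lin (b⁻ 0) e)) 0 + 1ℚ * Γ k l (lin (a 0) (lin (b⁻ 0) D)) 0
      ≡⟨ cong₂ _+_ side (ℚₚ.*-identityˡ _) ⟩
    Φ k (Ψ l (lin (b⁻ k) (lin (a l) e))) 0 + Γ k l (lin (a 0) (lin (b⁻ 0) D)) 0 ∎
    where
    open ≡-Reasoning
    G = ∘-isLinear (Γ-isLinear k l) (∘-isLinear (lin-isLinear (a 0)) (lin-isLinear (b⁻ 0)))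
    side = trans (Prod-telescope₂ b⁻ a⁻ k a b l e 0) (Prod-swap b⁻ a⁻ k _ 0)

  -- Γ k l is symmetric about Q / 2, hence takes the same value at 1 and Q - 1.
  Γ-δ : ∀ k l κ μ → Γ k l (κ ⊙ δ (a 0) ⊕ μ ⊙ δ (b⁻ 0)) 0 ≡ (κ + μ) * (R k * C l)
  Γ-δ k l κ μ = begin
    Γ k l (κ ⊙ δ (a 0) ⊕ μ ⊙ δ (b⁻ 0)) 0
      ≡⟨ G.combine (κ ⊙ δ (a 0)) μ (δ (b⁻ 0)) 0 ⟩
    Γ k l (κ ⊙ δ (a 0)) 0 + μ * Γ k l (δ (b⁻ 0)) 0
      ≡⟨ cong (_+ μ * Γ k l (δ (b⁻ 0)) 0) (G.scale κ (δ (a 0)) 0) ⟩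
    κ * Γ k l (δ (a 0)) 0 + μ * Γ k l (δ (b⁻ 0)) 0
      ≡⟨ cong₂ (λ x y → κ * x + μ * y) (value (a 0)) (trans (value (b⁻ 0)) (cong₂ (λ x y → y * (x * 1ℚ)) (R-sym k) (C-sym l))) ⟩
    κ * (C l * (R k * 1ℚ)) + μ * (C l * (R k * 1ℚ))
      ≡⟨ lemma κ μ (R k) (C l) ⟩
    (κ + μ) * (R k * C l) ∎
    where
    open ≡-Reasoning
    module G = IsLinear (Γ-isLinear k l)
    lemma : ∀ κ μ r c → κ * (c * (r * 1ℚ)) + μ * (c * (r * 1ℚ)) ≡ (κ + μ) * (r * c)
    lemma = solve-∀ ℚ-ring
    value : ∀ x → Γ k l (δ x) 0 ≡ evalProd (a ∘ suc) b l x * (evalProd (b⁻ ∘ suc) a⁻ k x * 1ℚ)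
    value x = trans (Prod-isLinear (b⁻ ∘ suc) a⁻ k .resp (Prod-δ (a ∘ suc) b l x) 0)
      (trans (scale (Prod-isLinear (b⁻ ∘ suc) a⁻ k) (evalProd (a ∘ suc) b l x) (δ x) 0)
             (cong (evalProd (a ∘ suc) b l x *_) (Prod-δ (b⁻ ∘ suc) a⁻ k x 0)))
    lemma₁ : ∀ q x → (- (1ℚ - q * 1ℚ) - (1ℚ + q * (1ℚ + x))) * (- (1ℚ - q * 1ℚ) - - (1ℚ + q * x)) ≡
                     (1ℚ + q * 0ℚ - (1ℚ + q * (1ℚ + x))) * (1ℚ + q * 0ℚ - - (1ℚ + q * x))
    lemma₁ = solve-∀ ℚ-ring
    lemma₂ : ∀ q x → (- (1ℚ - q * 1ℚ) - - (1ℚ - q * (1ℚ + x))) * (- (1ℚ - q * 1ℚ) - (1ℚ - q * x)) ≡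
                     (1ℚ + q * 0ℚ - - (1ℚ - q * (1ℚ + x))) * (1ℚ + q * 0ℚ - (1ℚ - q * x))
    lemma₂ = solve-∀ ℚ-ring
    C-sym : ∀ l → evalProd (a ∘ suc) b l (b⁻ 0) ≡ C l
    C-sym zero    = refl
    C-sym (suc l) = cong₂ _*_ (C-sym l)
      (subst (λ y → (b⁻ 0 - (1ℚ + Q * y)) * (b⁻ 0 - b l) ≡ (a 0 - (1ℚ + Q * y)) * (a 0 - b l))
        (sym (fromℕ-suc l)) (lemma₁ Q (fromℕ l)))
    R-sym : ∀ k → evalProd (b⁻ ∘ suc) a⁻ k (b⁻ 0) ≡ R k
    R-sym zero    = refl
    R-sym (suc k) = cong₂ _*_ (R-sym k)
      (subst (λ y → (b⁻ 0 - - (1ℚ - Q * y)) * (b⁻ 0 - a⁻ k) ≡ (a 0 - - (1ℚ - Q * y)) * (a 0 - a⁻ k))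
        (sym (fromℕ-suc (suc k))) (lemma₂ Q (fromℕ (suc k))))

-- Degree and parity of products of linear factors.

Monic-resp : ∀ {c n v w} → v ≗ w → Monic c n v → Monic c n w
Monic-resp e (u , s , f) = u , s , λ i → trans (sym (e i)) (f i)

Monic-lin : ∀ {c n w} r → Monic c n w → Monic c (suc n) (lin r w)
Monic-lin {w = w} r m = Monic-resp (λ i → lemma (w (suc i)) r (w i)) (Monic-combine (Monic-tail m) (- r) (Monic⇒Span m))
  where
  lemma : ∀ x r y → x + (- r) * y ≡ x - r * y
  lemma = solve-∀ ℚ-ring

Monic-Prod : ∀ {c m w} s t l → Monic c m w → Monic c (l ℕ.* 2 ℕ.+ m) (Prod s t l w)
Monic-Prod s t zero    μ = μ
Monic-Prod {c} {m} {w} s t (suc l) μ =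
  subst (λ n → Monic c n (Prod s t (suc l) w))
    (trans (ℕₚ.+-suc (l ℕ.* 2) (suc m)) (cong suc (ℕₚ.+-suc (l ℕ.* 2) m)))
    (Monic-Prod s t l (Monic-lin (s l) (Monic-lin (t l) μ)))

EvenZero : Series → Set
EvenZero w = ∀ i → w (i ℕ.* 2) ≡ 0ℚ

module _ (s : ℕ → ℚ) where

  EvenZero-Prod : ∀ l {w} → EvenZero w → EvenZero (Prod s (-_ ∘ s) l w)
  EvenZero-Prod zero    z = z
  EvenZero-Prod (suc l) {w} z = EvenZero-Prod l λ i → trans (lin-± (s l) w (i ℕ.* 2))
    (trans (cong₂ (λ x y → x - s l * s l * y) (z (suc i)) (z i)) (lemma (s l)))
    where
    lemma : ∀ x → 0ℚ - x * x * 0ℚ ≡ 0ℚ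
    lemma = solve-∀ ℚ-ring

  -- The product ∏ (x² - (s i)²) is monic of degree k in x², and the form annihilates its lower
  -- terms.
  Prod-leading : ∀ k {w} → (∀ {i} → i < k → w (i ℕ.* 2) ≡ 0ℚ) → Prod s (-_ ∘ s) k w 0 ≡ w (k ℕ.* 2)
  Prod-leading zero    z = refl
  Prod-leading (suc k) {w} z = trans
    (Prod-leading k λ {i} i<k → trans (lin-± (s k) w (i ℕ.* 2))
      (trans (cong₂ (λ x y → x - s k * s k * y) (z (s≤s i<k)) (z (ℕₚ.m<n⇒m<1+n i<k))) (lemma (s k))))
    (trans (lin-± (s k) w (k ℕ.* 2))
      (trans (cong (λ y → w (suc k ℕ.* 2) - s k * s k * y) (z ℕₚ.≤-refl)) (lemma′ (s k) _)))
    where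
    lemma : ∀ x → 0ℚ - x * x * 0ℚ ≡ 0ℚ
    lemma = solve-∀ ℚ-ring
    lemma′ : ∀ x y → y - x * x * 0ℚ ≡ y
    lemma′ = solve-∀ ℚ-ring

  -- These products form a unitriangular basis of the even polynomials, so vanishing on them
  -- transfers to the even powers. This takes the place of row operations.
  Prod-zero : ∀ n {w} → (∀ {k} → k < n → Prod s (-_ ∘ s) k w 0 ≡ 0ℚ) → ∀ {k} → k < n → w (k ℕ.* 2) ≡ 0ℚ
  Prod-zero (suc n) z {k} (s≤s k≤n) with ℕₚ.m≤n⇒m<n∨m≡n k≤n
  ... | inj₁ k<n  = Prod-zero n (z ∘ ℕₚ.m<n⇒m<1+n) k<n
  ... | inj₂ refl = trans (sym (Prod-leading n (Prod-zero n (z ∘ ℕₚ.m<n⇒m<1+n)))) (z ℕₚ.≤-refl)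

-- Factorials and falling factorials.

F : ℕ → ℚ
F n = fromℕ (n !)

F-suc : ∀ n → F (suc n) ≡ fromℕ (suc n) * F n
F-suc n = fromℕ-* (suc n) (n !)

F≢0 : ∀ n → F n ≢ 0ℚ
F≢0 n = fromℕ≢0 (n !) {{n ℕₚ.!≢0}}

falling : ℕ → ℕ → ℚ
falling k zero    = 1ℚ
falling k (suc n) = falling k n * (fromℕ k - fromℕ n)

falling-zero : ∀ {k} n → k < n → falling k n ≡ 0ℚ
falling-zero {k} (suc n) (s≤s k≤n) with ℕₚ.m≤n⇒m<n∨m≡n k≤n
... | inj₁ k<n  = trans (cong (_* (fromℕ k - fromℕ n)) (falling-zero n k<n)) (ℚₚ.*-zeroˡ (fromℕ k - fromℕ n))
... | inj₂ refl = trans (cong (falling k n *_) (ℚₚ.+-inverseʳ (fromℕ k))) (ℚₚ.*-zeroʳ (falling k n))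

falling-suc : ∀ k n → falling (suc k) (suc n) ≡ fromℕ (suc k) * falling k n
falling-suc k zero    = lemma (fromℕ (suc k))
  where
  lemma : ∀ x → 1ℚ * (x - 0ℚ) ≡ x * 1ℚ
  lemma = solve-∀ ℚ-ring
falling-suc k (suc n) = begin
  falling (suc k) (suc n) * (fromℕ (suc k) - fromℕ (suc n))
    ≡⟨ cong₂ _*_ (falling-suc k n) (cong₂ _-_ (fromℕ-suc k) (fromℕ-suc n)) ⟩
  fromℕ (suc k) * falling k n * (1ℚ + fromℕ k - (1ℚ + fromℕ n))
    ≡⟨ lemma (fromℕ (suc k)) (falling k n) (fromℕ k) (fromℕ n) ⟩
  fromℕ (suc k) * (falling k n * (fromℕ k - fromℕ n)) ∎
  where
  open ≡-Reasoning
  lemma : ∀ x f k n → x * f * (1ℚ + k - (1ℚ + n)) ≡ x * (f * (k - n))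
  lemma = solve-∀ ℚ-ring

falling-self : ∀ n → falling n n ≡ F n
falling-self zero    = refl
falling-self (suc n) = trans (falling-suc n n) (trans (cong (fromℕ (suc n) *_) (falling-self n)) (sym (F-suc n)))

-- Moments of a form with B(p(x + Q)) - B(p(x)) = p'(1) - p'(Q - 1).

module Moments (Q : ℚ) (Q≢0 : Q ≢ 0ℚ) (B : Series) where

  open Translation Q

  D₀ : Series
  D₀ = d (a 0) ⊕ (- 1ℚ) ⊙ d (b⁻ 0)

  κ : ℚ
  κ = a 0 - b⁻ 0

  -- The derivative of (x - r)(x - s) p is (r - s) p(r) at r and (s - r) p(s) at s. The minus sign
  -- in D₀ makes the two coefficients equal.
  lin-D₀ : lin (a 0) (lin (b⁻ 0) D₀) ≗ κ ⊙ δ (a 0) ⊕ κ ⊙ δ (b⁻ 0)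
  lin-D₀ n = begin
    lin r (lin s D₀) n
      ≡⟨ combine (∘-isLinear (lin-isLinear r) (lin-isLinear s)) (d r) (- 1ℚ) (d s) n ⟩
    lin r (lin s (d r)) n + - 1ℚ * lin r (lin s (d s)) n
      ≡⟨ cong₂ (λ x y → x + - 1ℚ * y)
           (trans (lin-comm r s (d r) n) (trans (lin-isLinear s .resp (lin-d r) n) (lin-δ s r n)))
           (trans (lin-isLinear r .resp (lin-d s) n) (lin-δ r s n)) ⟩
    (r - s) * δ r n + - 1ℚ * ((s - r) * δ s n)
      ≡⟨ lemma r s (δ r n) (δ s n) ⟩
    (r - s) * δ r n + (r - s) * δ s n ∎
    where
    open ≡-Reasoning
    r = a 0
    s = b⁻ 0
    lemma : ∀ r s x y → (r - s) * x + - 1ℚ * ((s - r) * y) ≡ (r - s) * x + (r - s) * y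
    lemma = solve-∀ ℚ-ring

  module _ (τB : τ B ≗ B ⊕ D₀) where

    private
      M : ℕ → ℕ → ℚ
      M k l = Φ k (Ψ l (tail B)) 0

      -- With α = a⁻ k and β = a l, the quadratic factors of G(x + Q) and G(x) differ by (x - α)(x +
      -- β) - (x + α)(x - β) = 2(β - α)x, and β - α = Q(k + l + 1).
      scaled : ∀ k l → fromℕ (suc (k ℕ.+ l)) * M k l * (Q + Q) ≡ (κ + κ) * (R k * C l)
      scaled k l = begin
        fromℕ (suc (k ℕ.+ l)) * M k l * (Q + Q)
          ≡⟨ lemma₁ Q (fromℕ (suc (k ℕ.+ l))) (M k l) (T B⁻ 0) ⟩
        T B⁻ 0 + (fromℕ (suc (k ℕ.+ l)) * (Q + Q)) * M k l - T B⁻ 0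
          ≡⟨ cong (λ x → T B⁻ 0 + x * M k l - T B⁻ 0) coefficient ⟩
        T B⁻ 0 + (a l - a⁻ k + (a l - a⁻ k)) * M k l - T B⁻ 0
          ≡⟨ cong (_- T B⁻ 0) (L.combine B⁻ (a l - a⁻ k + (a l - a⁻ k)) (tail B) 0) ⟨
        T (B⁻ ⊕ (a l - a⁻ k + (a l - a⁻ k)) ⊙ tail B) 0 - T B⁻ 0
          ≡⟨ cong (_- T B⁻ 0) (L.resp (λ n → lemma₂ (a l) (a⁻ k) (B (suc (suc n))) (B (suc n)) (B n)) 0) ⟨
        T (lin (a⁻ k) (lin (b l) B)) 0 - T B⁻ 0
          ≡⟨ cong (_- T B⁻ 0) (telescope k l B B D₀ τB) ⟩
        T B⁻ 0 + Γ k l (lin (a 0) (lin (b⁻ 0) D₀)) 0 - T B⁻ 0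
          ≡⟨ lemma₃ (T B⁻ 0) _ ⟩
        Γ k l (lin (a 0) (lin (b⁻ 0) D₀)) 0
          ≡⟨ trans (Γ-isLinear k l .resp lin-D₀ 0) (Γ-δ k l κ κ) ⟩
        (κ + κ) * (R k * C l) ∎
        where
        open ≡-Reasoning
        T = Φ k ∘ Ψ l
        B⁻ = lin (b⁻ k) (lin (a l) B)
        module L = IsLinear (ΦΨ-isLinear k l)
        lemma₀ : ∀ q k l → (1ℚ + (k + l)) * (q + q) ≡ 1ℚ + q * l - (1ℚ - q * (1ℚ + k)) + (1ℚ + q * l - (1ℚ - q * (1ℚ + k)))
        lemma₀ = solve-∀ ℚ-ring
        coefficient : fromℕ (suc (k ℕ.+ l)) * (Q + Q) ≡ a l - a⁻ k + (a l - a⁻ k)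
        coefficient rewrite fromℕ-suc (k ℕ.+ l) | fromℕ-+ k l | fromℕ-suc k = lemma₀ Q (fromℕ k) (fromℕ l)
        lemma₁ : ∀ q s m t → s * m * (q + q) ≡ t + (s * (q + q)) * m - t
        lemma₁ = solve-∀ ℚ-ring
        lemma₂ : ∀ β α x y z → x - - β * y - α * (y - - β * z) ≡
                 x - β * y - - α * (y - β * z) + (β - α + (β - α)) * y
        lemma₂ = solve-∀ ℚ-ring
        lemma₃ : ∀ x y → x + y - x ≡ y
        lemma₃ = solve-∀ ℚ-ring

      Q+Q≢0 : Q + Q ≢ 0ℚ
      Q+Q≢0 e = *-≢0 Q≢0 (fromℕ-suc≢0 1) (trans (lemma Q) e)
        where
        lemma : ∀ q → q * (1ℚ + 1ℚ) ≡ q + q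
        lemma = solve-∀ ℚ-ring

    moment-1 : B 1 * Q ≡ κ
    moment-1 = *-cancelʳ (1ℚ + 1ℚ) (fromℕ-suc≢0 1) (trans (lemma₁ (B 1) Q) (trans (scaled 0 0) (lemma₂ κ)))
      where
      lemma₁ : ∀ x q → x * q * (1ℚ + 1ℚ) ≡ 1ℚ * x * (q + q)
      lemma₁ = solve-∀ ℚ-ring
      lemma₂ : ∀ k → (k + k) * (1ℚ * 1ℚ) ≡ k * (1ℚ + 1ℚ)
      lemma₂ = solve-∀ ℚ-ring

    moment : ∀ k l → fromℕ (suc (k ℕ.+ l)) * Φ k (Ψ l (tail B)) 0 ≡ B 1 * (R k * C l)
    moment k l = *-cancelʳ (Q + Q) Q+Q≢0 (trans (scaled k l)
      (trans (cong (λ x → (x + x) * (R k * C l)) (sym moment-1)) (lemma (B 1) Q (R k * C l))))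
      where
      lemma : ∀ x q y → (x * q + x * q) * y ≡ x * y * (q + q)
      lemma = solve-∀ ℚ-ring

    -- Take p = x: its derivative is constant, so the right side cancels and the left side is Q
    -- times B 0.
    B-zero : B 0 ≡ 0ℚ
    B-zero = *-cancelʳ Q Q≢0 (trans (lemma₁ (B 1) (B 0) Q) (trans (cong (_- B 1) (τB 1)) (lemma₂ (B 1) Q)))
      where
      lemma₁ : ∀ x y q → y * q ≡ x + q * y - x
      lemma₁ = solve-∀ ℚ-ring
      lemma₂ : ∀ x q → x + (1ℚ * 1ℚ + - 1ℚ * (1ℚ * 1ℚ)) - x ≡ 0ℚ * q
      lemma₂ = solve-∀ ℚ-ring

    -- The telescoping sum of an odd function about Q / 2, obtained from the factor x - Q / 2.
    Ψ-zero : ∀ l → Ψ l B 0 ≡ 0ℚ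
    Ψ-zero zero    = B-zero
    Ψ-zero (suc l) = *-cancelʳ coeff coeff≢0 (begin
      Ψ (suc l) B 0 * coeff
        ≡⟨ lemma₁ coeff (Ψ (suc l) B 0) μ (Ψ l B⁻ 0) ⟩
      Ψ l B⁻ 0 + coeff * Ψ (suc l) B 0 + μ * 0ℚ - Ψ l B⁻ 0
        ≡⟨ cong (λ x → Ψ l B⁻ 0 + coeff * Ψ (suc l) B 0 + μ * x - Ψ l B⁻ 0) (Ψ-zero l) ⟨
      Ψ l B⁻ 0 + coeff * Ψ (suc l) B 0 + μ * Ψ l B 0 - Ψ l B⁻ 0
        ≡⟨ cong (λ x → x + μ * Ψ l B 0 - Ψ l B⁻ 0) (L.combine B⁻ coeff (lin (a l) (lin (b l) B)) 0) ⟨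
      Ψ l (B⁻ ⊕ coeff ⊙ lin (a l) (lin (b l) B)) 0 + μ * Ψ l B 0 - Ψ l B⁻ 0
        ≡⟨ cong (_- Ψ l B⁻ 0) (L.combine (B⁻ ⊕ coeff ⊙ lin (a l) (lin (b l) B)) μ B 0) ⟨
      Ψ l (B⁻ ⊕ coeff ⊙ lin (a l) (lin (b l) B) ⊕ μ ⊙ B) 0 - Ψ l B⁻ 0
        ≡⟨ cong (_- Ψ l B⁻ 0) (L.resp (λ n → lemma₂ (a⁻ 0) (a l) h (B (suc (suc (suc n)))) (B (suc (suc n))) (B (suc n)) (B n)) 0) ⟨
      Ψ l (lin (a⁻ 0) (lin (b l) (lin (- h) B))) 0 - Ψ l B⁻ 0
        ≡⟨ cong (_- Ψ l B⁻ 0) (telescope 0 l (lin (- h) B) (lin h B) (lin h D₀) τB′) ⟩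
      Ψ l B⁻ 0 + Γ 0 l (lin (a 0) (lin (b⁻ 0) (lin h D₀))) 0 - Ψ l B⁻ 0
        ≡⟨ cong (λ x → Ψ l B⁻ 0 + x - Ψ l B⁻ 0) (trans (Γ-isLinear 0 l .resp lin-D₀′ 0) (Γ-δ 0 l (κ * (a 0 - h)) (κ * (b⁻ 0 - h)))) ⟩
      Ψ l B⁻ 0 + (κ * (a 0 - h) + κ * (b⁻ 0 - h)) * (R 0 * C l) - Ψ l B⁻ 0
        ≡⟨ cong (λ x → Ψ l B⁻ 0 + x * (R 0 * C l) - Ψ l B⁻ 0) cancel ⟩
      Ψ l B⁻ 0 + 0ℚ * (R 0 * C l) - Ψ l B⁻ 0
        ≡⟨ lemma₃ (Ψ l B⁻ 0) (R 0 * C l) coeff ⟩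
      0ℚ * coeff ∎)
      where
      open ≡-Reasoning
      module L = IsLinear (Prod-isLinear a b l)
      h = Q * ½
      h+h : h + h ≡ Q
      h+h = trans (sym (ℚₚ.*-distribˡ-+ Q ½ ½)) (ℚₚ.*-identityʳ Q)
      B⁻ = lin (b⁻ 0) (lin (a l) (lin h B))
      -- With α = a⁻ 0 and β = a l, the difference (x - α)(x + β)(x + h) - (x + α)(x - β)(x - h) is
      -- even and equals coeff (x² - β²) + μ. Here coeff = Q(2l + 3), which is nonzero, and the μ
      -- term vanishes by induction.
      coeff = a l - a⁻ 0 + h + (a l - a⁻ 0 + h)
      μ = coeff * (a l * a l) - a⁻ 0 * a l * (h + h)
      lemma₀ : ∀ q x → (q * (1ℚ + 1ℚ + 1ℚ + (x + x))) ≡ 1ℚ + q * x - (1ℚ - q * 1ℚ) + (1ℚ + q * x - (1ℚ - q * 1ℚ)) + q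
      lemma₀ = solve-∀ ℚ-ring
      lemma₀′ : ∀ x h → x + x + (h + h) ≡ x + h + (x + h)
      lemma₀′ = solve-∀ ℚ-ring
      coeff-value : Q * fromℕ (3 ℕ.+ (l ℕ.+ l)) ≡ coeff
      coeff-value = trans (cong (Q *_) (trans (fromℕ-+ 3 (l ℕ.+ l)) (cong (fromℕ 3 +_) (fromℕ-+ l l))))
        (trans (lemma₀ Q (fromℕ l)) (trans (cong (λ x → a l - a⁻ 0 + (a l - a⁻ 0) + x) (sym h+h)) (lemma₀′ (a l - a⁻ 0) h)))
      coeff≢0 : coeff ≢ 0ℚ
      coeff≢0 e = *-≢0 Q≢0 (fromℕ-suc≢0 (2 ℕ.+ (l ℕ.+ l))) (trans coeff-value e)
      lemma₁ : ∀ k x m y → x * k ≡ y + k * x + m * 0ℚ - y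
      lemma₁ = solve-∀ ℚ-ring
      lemma₂ : ∀ α β h w x y z →
        (w - - h * x - - β * (x - - h * y)) - α * (x - - h * y - - β * (y - - h * z)) ≡
        (w - h * x - β * (x - h * y)) - - α * (x - h * y - β * (y - h * z))
        + (β - α + h + (β - α + h)) * (x - - β * y - β * (y - - β * z))
        + ((β - α + h + (β - α + h)) * (β * β) - α * β * (h + h)) * z
      lemma₂ = solve-∀ ℚ-ring
      lemma₃ : ∀ x y k → x + 0ℚ * y - x ≡ 0ℚ * k
      lemma₃ = solve-∀ ℚ-ring
      lemma₄ : ∀ h → - h ≡ h - (h + h)
      lemma₄ = solve-∀ ℚ-ring
      lemma₅ : ∀ k h q → k * (1ℚ + q * 0ℚ - h) + k * (- (1ℚ - q * 1ℚ) - h) ≡ k * (q - (h + h))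
      lemma₅ = solve-∀ ℚ-ring
      cancel : κ * (a 0 - h) + κ * (b⁻ 0 - h) ≡ 0ℚ
      cancel = trans (lemma₅ κ h Q) (trans (cong (λ x → κ * (Q - x)) h+h)
                 (trans (cong (κ *_) (ℚₚ.+-inverseʳ Q)) (ℚₚ.*-zeroʳ κ)))
      τB′ : τ (lin (- h) B) ≗ lin h B ⊕ lin h D₀
      τB′ n = trans (sym (lin-τ h (trans (lemma₄ h) (cong (λ x → h - x) h+h)) B n))
        (trans (lin-isLinear h .resp (λ i → trans (τB i) (cong (B i +_) (sym (ℚₚ.*-identityˡ (D₀ i))))) n)
        (trans (lin-isLinear h .combine B 1ℚ D₀ n) (cong (lin h B n +_) (ℚₚ.*-identityˡ (lin h D₀ n)))))
      lin-D₀′ : lin (a 0) (lin (b⁻ 0) (lin h D₀)) ≗ (κ * (a 0 - h)) ⊙ δ (a 0) ⊕ (κ * (b⁻ 0 - h)) ⊙ δ (b⁻ 0)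
      lin-D₀′ n = begin
        lin (a 0) (lin (b⁻ 0) (lin h D₀)) n
          ≡⟨ lin-isLinear (a 0) .resp (lin-comm (b⁻ 0) h D₀) n ⟩
        lin (a 0) (lin h (lin (b⁻ 0) D₀)) n
          ≡⟨ lin-comm (a 0) h (lin (b⁻ 0) D₀) n ⟩
        lin h (lin (a 0) (lin (b⁻ 0) D₀)) n
          ≡⟨ lin-isLinear h .resp lin-D₀ n ⟩
        lin h (κ ⊙ δ (a 0) ⊕ κ ⊙ δ (b⁻ 0)) n
          ≡⟨ lin-isLinear h .combine (κ ⊙ δ (a 0)) κ (δ (b⁻ 0)) n ⟩
        lin h (κ ⊙ δ (a 0)) n + κ * lin h (δ (b⁻ 0)) n
          ≡⟨ cong₂ (λ x y → x + κ * y)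
               (trans (scale (lin-isLinear h) κ (δ (a 0)) n) (cong (κ *_) (lin-δ h (a 0) n)))
               (lin-δ h (b⁻ 0) n) ⟩
        κ * ((a 0 - h) * δ (a 0) n) + κ * ((b⁻ 0 - h) * δ (b⁻ 0) n)
          ≡⟨ cong₂ _+_ (ℚₚ.*-assoc κ (a 0 - h) _) (ℚₚ.*-assoc κ (b⁻ 0 - h) _) ⟨
        κ * (a 0 - h) * δ (a 0) n + κ * (b⁻ 0 - h) * δ (b⁻ 0) n ∎

    B-even : EvenZero B
    B-even i = Prod-zero a (suc i) (λ {k} _ → Ψ-zero k) ℕₚ.≤-refl

-- Elimination of the rescaled Hilbert matrix.

module Elimination (Q : ℚ) (Q≢0 : Q ≢ 0ℚ) (B : Series) where

  open Translation Q
  open Moments Q Q≢0 B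

  -- The factors by which `C` and `R` grow from r to r + 1.
  σ ρ : ℕ → ℚ
  σ r = (a 0 - a (suc r)) * (a 0 - b r)
  ρ r = (a 0 - b⁻ (suc r)) * (a 0 - a⁻ r)

  -- The ratio of V n (l + 1) n to V n l n according to the closed form in `V-value`: subtracting
  -- this multiple clears the entry at k = n.
  γ : ℕ → ℕ → ℚ
  γ n l = fromℕ (suc (n ℕ.+ l)) * fromℕ (suc (n ℕ.+ l)) * σ (n ℕ.+ l)
        * (ℤ.+ 1 / (suc (n ℕ.* 2 ℕ.+ l) ℕ.* suc (suc (n ℕ.* 2 ℕ.+ l))))

  γ-denominator : ∀ n l → γ n l * (fromℕ (suc (n ℕ.* 2 ℕ.+ l)) * fromℕ (suc (suc (n ℕ.* 2 ℕ.+ l))))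
                        ≡ fromℕ (suc (n ℕ.+ l)) * fromℕ (suc (n ℕ.+ l)) * σ (n ℕ.+ l)
  γ-denominator n l = begin
    x * y * (fromℕ p * fromℕ (suc p))   ≡⟨ cong (x * y *_) (fromℕ-* p (suc p)) ⟨
    x * y * fromℕ (p ℕ.* suc p)         ≡⟨ ℚₚ.*-assoc x y _ ⟩
    x * (y * fromℕ (p ℕ.* suc p))       ≡⟨ cong (x *_) (/-fromℕ (ℤ.+ 1) (p ℕ.* suc p)) ⟩
    x * 1ℚ                              ≡⟨ ℚₚ.*-identityʳ x ⟩
    x                                   ∎
    where
    open ≡-Reasoning
    p = suc (n ℕ.* 2 ℕ.+ l)
    x = fromℕ (suc (n ℕ.+ l)) * fromℕ (suc (n ℕ.+ l)) * σ (n ℕ.+ l)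
    y = ℤ.+ 1 / (p ℕ.* suc p)

  -- In the bases Φ k, Ψ l the moments are those of a Hilbert matrix 1 / (k + l + 1)
  -- up to row and column factors; U is its elimination by neighbouring columns.
  U : ℕ → ℕ → Series → Series
  U zero    l c = Ψ l c
  U (suc n) l c = U n (suc l) c ⊕ (- γ n l) ⊙ U n l c

  U-monic : ∀ n l → Monic B ((n ℕ.+ l) ℕ.* 2) (U n l B)
  U-monic zero    l = subst (λ m → Monic B m (Ψ l B)) (ℕₚ.+-identityʳ _) (Monic-Prod a b l (Monic-self B))
  U-monic (suc n) l = Monic-combine
    (subst (λ m → Monic B (m ℕ.* 2) (U n (suc l) B)) (ℕₚ.+-suc n l) (U-monic n (suc l)))
    (- γ n l) (Span-mono (ℕₚ.n≤1+n _) (Monic⇒Span (U-monic n l)))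

  U-evenZero : ∀ n l {c} → EvenZero c → EvenZero (U n l c)
  U-evenZero zero    l z = EvenZero-Prod a l z
  U-evenZero (suc n) l z i = trans (cong₂ (λ x y → x + (- γ n l) * y) (U-evenZero n (suc l) z i) (U-evenZero n l z i))
                                   (trans (ℚₚ.+-identityˡ _) (ℚₚ.*-zeroʳ (- γ n l)))

  U-tail : ∀ n l c → U n l (tail c) ≗ tail (U n l c)
  U-tail zero    l c i = Prod-tail a b l c i
  U-tail (suc n) l c i = cong₂ (λ x y → x + (- γ n l) * y) (U-tail n (suc l) c i) (U-tail n l c i)

  V : ℕ → ℕ → ℕ → ℚ
  V n l k = Φ k (U n l (tail B)) 0

  h : ℕ → ℚ
  h n = V n 0 n

  module _ (τB : τ B ≗ B ⊕ D₀) where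

    -- Induction on n, starting from 1 / (l + k + 1); the denominators are cleared as factorials.
    -- The indices come with equations so that the hypothesis at l + 1 applies to the reassociated
    -- sums. The falling factorial is what makes the array triangular.
    V-value : ∀ n l k {p r t} → p ≡ n ℕ.* 2 ℕ.+ l → r ≡ n ℕ.+ l → t ≡ n ℕ.+ (l ℕ.+ k) →
      V n l k * (F p * F (suc t)) ≡ B 1 * R k * C r * F r * F n * falling k n * F (l ℕ.+ k)
    V-value zero l k refl refl refl = begin
      V 0 l k * (F l * F (suc (l ℕ.+ k)))
        ≡⟨ cong (λ x → V 0 l k * (F l * x)) (F-suc (l ℕ.+ k)) ⟩
      V 0 l k * (F l * (fromℕ (suc (l ℕ.+ k)) * F (l ℕ.+ k)))
        ≡⟨ lemma₁ (V 0 l k) (F l) (fromℕ (suc (l ℕ.+ k))) (F (l ℕ.+ k)) ⟩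
      fromℕ (suc (l ℕ.+ k)) * V 0 l k * (F l * F (l ℕ.+ k))
        ≡⟨ cong (_* (F l * F (l ℕ.+ k))) (subst (λ m → fromℕ (suc m) * V 0 l k ≡ B 1 * (R k * C l))
             (ℕₚ.+-comm k l) (moment τB k l)) ⟩
      B 1 * (R k * C l) * (F l * F (l ℕ.+ k))
        ≡⟨ lemma₂ (B 1) (R k) (C l) (F l) (F (l ℕ.+ k)) ⟩
      B 1 * R k * C l * F l * 1ℚ * 1ℚ * F (l ℕ.+ k) ∎
      where
      open ≡-Reasoning
      lemma₁ : ∀ v f m g → v * (f * (m * g)) ≡ m * v * (f * g)
      lemma₁ = solve-∀ ℚ-ring
      lemma₂ : ∀ x r c f g → x * (r * c) * (f * g) ≡ x * r * c * f * 1ℚ * 1ℚ * g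
      lemma₂ = solve-∀ ℚ-ring
    V-value (suc n) l k refl refl refl = begin
      V (suc n) l k * (F (suc (suc p)) * F (suc (suc t)))
        ≡⟨ cong₂ _*_ split (cong₂ _*_ (trans (F-suc (suc p)) (cong (p₂ *_) (F-suc p))) (F-suc (suc t))) ⟩
      (V₂ + (- g) * V₁) * (p₂ * (p₁ * F p) * (t₂ * F (suc t)))
        ≡⟨ lemma₁ V₂ g V₁ p₂ p₁ (F p) t₂ (F (suc t)) ⟩
      p₂ * (V₂ * (p₁ * F p * (t₂ * F (suc t)))) - g * (p₁ * p₂) * t₂ * (V₁ * (F p * F (suc t)))
        ≡⟨ cong₂ (λ x y → p₂ * x - y * t₂ * (V₁ * (F p * F (suc t)))) (trans (cong (V₂ *_) (sym (cong₂ _*_ (F-suc p) (F-suc (suc t)))))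
             (V-value n (suc l) k (sym (ℕₚ.+-suc (n ℕ.* 2) l)) (sym (ℕₚ.+-suc n l)) (sym (ℕₚ.+-suc n (l ℕ.+ k)))))
             (γ-denominator n l) ⟩
      p₂ * (B 1 * R k * (C r * σ r) * F (suc r) * F n * f * F (suc m)) - r₁ * r₁ * σ r * t₂ * (V₁ * (F p * F (suc t)))
        ≡⟨ cong₂ (λ x y → p₂ * (B 1 * R k * (C r * σ r) * F (suc r) * F n * f * x) - r₁ * r₁ * σ r * t₂ * y)
             (F-suc m) (V-value n l k refl refl refl) ⟩
      p₂ * (B 1 * R k * (C r * σ r) * F (suc r) * F n * f * (m₁ * F m)) - r₁ * r₁ * σ r * t₂ * (B 1 * R k * C r * F r * F n * f * F m)
        ≡⟨ cong (λ x → p₂ * (B 1 * R k * (C r * σ r) * x * F n * f * (m₁ * F m)) - r₁ * r₁ * σ r * t₂ * (B 1 * R k * C r * F r * F n * f * F m)) (F-suc r) ⟩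
      p₂ * (B 1 * R k * (C r * σ r) * (r₁ * F r) * F n * f * (m₁ * F m)) - r₁ * r₁ * σ r * t₂ * (B 1 * R k * C r * F r * F n * f * F m)
        ≡⟨ lemma₂ p₂ (B 1) (R k) (C r) (σ r) r₁ (F r) (F n) f m₁ (F m) t₂ ⟩
      B 1 * R k * (C r * σ r) * (r₁ * F r) * F n * f * F m * (p₂ * m₁ - r₁ * t₂)
        ≡⟨ cong (B 1 * R k * (C r * σ r) * (r₁ * F r) * F n * f * F m *_) numbers ⟩
      B 1 * R k * (C r * σ r) * (r₁ * F r) * F n * f * F m * (n₁ * (fromℕ k - fromℕ n))
        ≡⟨ lemma₃ (B 1 * R k * (C r * σ r)) (r₁ * F r) (F n) f (F m) n₁ (fromℕ k - fromℕ n) ⟩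
      B 1 * R k * (C r * σ r) * (r₁ * F r) * (n₁ * F n) * (f * (fromℕ k - fromℕ n)) * F m
        ≡⟨ cong₂ (λ x y → B 1 * R k * (C r * σ r) * x * y * (f * (fromℕ k - fromℕ n)) * F m) (F-suc r) (F-suc n) ⟨
      B 1 * R k * C (suc r) * F (suc r) * F (suc n) * falling k (suc n) * F m ∎
      where
      open ≡-Reasoning
      p = n ℕ.* 2 ℕ.+ l
      r = n ℕ.+ l
      m = l ℕ.+ k
      t = n ℕ.+ m
      g = γ n l
      f = falling k n
      p₁ = fromℕ (suc p)
      p₂ = fromℕ (suc (suc p))
      r₁ = fromℕ (suc r)
      m₁ = fromℕ (suc m)
      n₁ = fromℕ (suc n)
      t₂ = fromℕ (suc (suc t))
      V₁ = V n l k
      V₂ = V n (suc l) k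
      split : V (suc n) l k ≡ V₂ + (- g) * V₁
      split = Prod-isLinear a⁻ b⁻ k .combine (U n (suc l) (tail B)) (- g) (U n l (tail B)) 0
      lemma₁ : ∀ V₂ g V₁ p₂ p₁ Fp t₂ Ft → (V₂ + (- g) * V₁) * (p₂ * (p₁ * Fp) * (t₂ * Ft)) ≡
        p₂ * (V₂ * (p₁ * Fp * (t₂ * Ft))) - g * (p₁ * p₂) * t₂ * (V₁ * (Fp * Ft))
      lemma₁ = solve-∀ ℚ-ring
      lemma₂ : ∀ p₂ B R C σ r₁ Fr Fn f m₁ Fm t₂ →
        p₂ * (B * R * (C * σ) * (r₁ * Fr) * Fn * f * (m₁ * Fm)) - r₁ * r₁ * σ * t₂ * (B * R * C * Fr * Fn * f * Fm) ≡
        B * R * (C * σ) * (r₁ * Fr) * Fn * f * Fm * (p₂ * m₁ - r₁ * t₂)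
      lemma₂ = solve-∀ ℚ-ring
      lemma₃ : ∀ x y z f w n d → x * y * z * f * w * (n * d) ≡ x * y * (n * z) * (f * d) * w
      lemma₃ = solve-∀ ℚ-ring
      lemma₄ : ∀ n l k → (1ℚ + (1ℚ + (n * (1ℚ + 1ℚ) + l))) * (1ℚ + (l + k)) - (1ℚ + (n + l)) * (1ℚ + (1ℚ + (n + (l + k))))
             ≡ (1ℚ + n) * (k - n)
      lemma₄ = solve-∀ ℚ-ring
      -- Two products of linear terms differ by (n + 1)(k - n): the first factor extends n!, the
      -- second extends `falling k n`.
      numbers : p₂ * m₁ - r₁ * t₂ ≡ n₁ * (fromℕ k - fromℕ n)
      numbers rewrite fromℕ-suc (suc p) | fromℕ-suc p | fromℕ-+ (n ℕ.* 2) l | fromℕ-* n 2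
        | fromℕ-suc r | fromℕ-+ n l | fromℕ-suc n | fromℕ-suc (suc t) | fromℕ-suc t | fromℕ-+ n m | fromℕ-suc m | fromℕ-+ l k
        = lemma₄ (fromℕ n) (fromℕ l) (fromℕ k)

    V-zero : ∀ n {k} → k < n → V n 0 k ≡ 0ℚ
    V-zero n {k} k<n = *-cancelʳ (F (n ℕ.* 2 ℕ.+ 0) * F (suc (n ℕ.+ k))) (*-≢0 (F≢0 (n ℕ.* 2 ℕ.+ 0)) (F≢0 (suc (n ℕ.+ k)))) (begin
      V n 0 k * (F (n ℕ.* 2 ℕ.+ 0) * F (suc (n ℕ.+ k)))
        ≡⟨ V-value n 0 k refl refl refl ⟩
      x * falling k n * F k
        ≡⟨ cong (λ y → x * y * F k) (falling-zero n k<n) ⟩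
      x * 0ℚ * F k
        ≡⟨ lemma x (F k) (F (n ℕ.* 2 ℕ.+ 0) * F (suc (n ℕ.+ k))) ⟩
      0ℚ * (F (n ℕ.* 2 ℕ.+ 0) * F (suc (n ℕ.+ k))) ∎)
      where
      open ≡-Reasoning
      x = B 1 * R k * C (n ℕ.+ 0) * F (n ℕ.+ 0) * F n
      lemma : ∀ x y z → x * 0ℚ * y ≡ 0ℚ * z
      lemma = solve-∀ ℚ-ring

    h-value : ∀ n → h n * (F (n ℕ.* 2) * F (suc (n ℕ.* 2))) ≡ B 1 * R n * C n * F n * F n * F n * F n
    h-value n = trans
      (V-value n 0 n (sym (ℕₚ.+-identityʳ _)) (sym (ℕₚ.+-identityʳ n))
        (trans (ℕₚ.*-comm n 2) (cong (n ℕ.+_) (ℕₚ.+-identityʳ n))))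
      (cong (λ x → B 1 * R n * C n * F n * F n * x * F n) (falling-self n))

    -- Quotient of consecutive cases of `h-value`. The difference of squares comes from ρ n * σ n =
    -- -Q²x² (2 - Q - Qx)(2 - Q + Qx).
    h-suc : ∀ n → let x = fromℕ (suc n) in
      h (suc n) * ((1ℚ + 1ℚ) * (1ℚ + 1ℚ) * (x + x + 1ℚ) * (x + x - 1ℚ)) ≡
      - (Q * Q) * (x * x * (x * x) * ((Q - (1ℚ + 1ℚ)) * (Q - (1ℚ + 1ℚ)) - Q * x * (Q * x))) * h n
    -- The two new factorials contribute (2x - 1)(2x) and (2x)(2x + 1); the x² in (2x)² cancels
    -- against the x² in ρ n * σ n, leaving the 4.
    h-suc n = *-cancelʳ (x * x * (F p * F (suc p))) (*-≢0 (*-≢0 x≢0 x≢0) (*-≢0 (F≢0 p) (F≢0 (suc p)))) (begin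
      h (suc n) * ((1ℚ + 1ℚ) * (1ℚ + 1ℚ) * (x + x + 1ℚ) * (x + x - 1ℚ)) * (x * x * (F p * F (suc p)))
        ≡⟨ lemma₁ (h (suc n)) x (F p) (F (suc p)) ⟩
      h (suc n) * ((x + x) * ((x + x - 1ℚ) * F p) * ((x + x + 1ℚ) * ((x + x) * F (suc p))))
        ≡⟨ cong (h (suc n) *_) (cong₂ (λ y z → y * z) p₂ p₃) ⟨
      h (suc n) * (F (suc (suc p)) * F (suc (suc (suc p))))
        ≡⟨ h-value (suc n) ⟩
      B 1 * (R n * ρ n) * (C n * σ n) * F (suc n) * F (suc n) * F (suc n) * F (suc n)
        ≡⟨ cong (λ y → B 1 * (R n * ρ n) * (C n * σ n) * y * y * y * y) (F-suc n) ⟩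
      B 1 * (R n * ρ n) * (C n * σ n) * (x * F n) * (x * F n) * (x * F n) * (x * F n)
        ≡⟨ lemma₂ (B 1) (R n) (ρ n) (C n) (σ n) x (F n) ⟩
      ρ n * σ n * (x * x * (x * x)) * (B 1 * R n * C n * F n * F n * F n * F n)
        ≡⟨ cong₂ (λ y z → y * (x * x * (x * x)) * z) ρσ (sym (h-value n)) ⟩
      - (Q * Q) * (x * x) * ((Q - (1ℚ + 1ℚ)) * (Q - (1ℚ + 1ℚ)) - Q * x * (Q * x)) * (x * x * (x * x)) * (h n * (F p * F (suc p)))
        ≡⟨ lemma₃ Q x _ (h n) (F p * F (suc p)) ⟩
      - (Q * Q) * (x * x * (x * x) * ((Q - (1ℚ + 1ℚ)) * (Q - (1ℚ + 1ℚ)) - Q * x * (Q * x))) * h n * (x * x * (F p * F (suc p))) ∎)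
      where
      open ≡-Reasoning
      p = n ℕ.* 2
      x = fromℕ (suc n)
      x≢0 = fromℕ-suc≢0 n
      lemma₁ : ∀ h x f g → h * ((1ℚ + 1ℚ) * (1ℚ + 1ℚ) * (x + x + 1ℚ) * (x + x - 1ℚ)) * (x * x * (f * g)) ≡
        h * ((x + x) * ((x + x - 1ℚ) * f) * ((x + x + 1ℚ) * ((x + x) * g)))
      lemma₁ = solve-∀ ℚ-ring
      lemma₂ : ∀ B R ρ C σ x f → B * (R * ρ) * (C * σ) * (x * f) * (x * f) * (x * f) * (x * f) ≡
        ρ * σ * (x * x * (x * x)) * (B * R * C * f * f * f * f)
      lemma₂ = solve-∀ ℚ-ring
      lemma₃ : ∀ q x u h f → - (q * q) * (x * x) * u * (x * x * (x * x)) * (h * f) ≡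
        - (q * q) * (x * x * (x * x) * u) * h * (x * x * f)
      lemma₃ = solve-∀ ℚ-ring
      lemma₄ : ∀ q n → (1ℚ + q * 0ℚ - - (1ℚ - q * (1ℚ + (1ℚ + n)))) * (1ℚ + q * 0ℚ - (1ℚ - q * (1ℚ + n)))
        * ((1ℚ + q * 0ℚ - (1ℚ + q * (1ℚ + n))) * (1ℚ + q * 0ℚ - - (1ℚ + q * n))) ≡
        - (q * q) * ((1ℚ + n) * (1ℚ + n)) * ((q - (1ℚ + 1ℚ)) * (q - (1ℚ + 1ℚ)) - q * (1ℚ + n) * (q * (1ℚ + n)))
      lemma₄ = solve-∀ ℚ-ring
      ρσ : ρ n * σ n ≡ - (Q * Q) * (x * x) * ((Q - (1ℚ + 1ℚ)) * (Q - (1ℚ + 1ℚ)) - Q * x * (Q * x))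
      ρσ rewrite fromℕ-suc (suc n) | fromℕ-suc n = lemma₄ Q (fromℕ n)
      lemma₅ : ∀ n → 1ℚ + n * (1ℚ + 1ℚ) ≡ 1ℚ + n + (1ℚ + n) - 1ℚ
      lemma₅ = solve-∀ ℚ-ring
      lemma₆ : ∀ x → 1ℚ + (x - 1ℚ) ≡ x
      lemma₆ = solve-∀ ℚ-ring
      x₁ : fromℕ (suc p) ≡ x + x - 1ℚ
      x₁ = trans (fromℕ-suc p) (trans (cong (λ y → 1ℚ + y) (fromℕ-* n 2))
             (trans (lemma₅ (fromℕ n)) (cong (λ y → y + y - 1ℚ) (sym (fromℕ-suc n)))))
      x₂ : fromℕ (suc (suc p)) ≡ x + x
      x₂ = trans (fromℕ-suc (suc p)) (trans (cong (λ y → 1ℚ + y) x₁) (lemma₆ (x + x)))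
      x₃ : fromℕ (suc (suc (suc p))) ≡ x + x + 1ℚ
      x₃ = trans (fromℕ-suc (suc (suc p))) (trans (cong (λ y → 1ℚ + y) x₂) (ℚₚ.+-comm 1ℚ (x + x)))
      p₂ : F (suc (suc p)) ≡ (x + x) * ((x + x - 1ℚ) * F p)
      p₂ = trans (F-suc (suc p)) (cong₂ _*_ x₂ (trans (F-suc p) (cong (_* F p) x₁)))
      p₃ : F (suc (suc (suc p))) ≡ (x + x + 1ℚ) * ((x + x) * F (suc p))
      p₃ = trans (F-suc (suc (suc p))) (cong₂ _*_ x₃ (trans (F-suc (suc p)) (cong (_* F (suc p)) x₂)))

    U-antidiagonal : Antidiagonal 0 (λ n → U n 0 B) h
    U-antidiagonal = record
      { even  = λ n → U-evenZero n 0 (B-even τB)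
      ; upper = λ n → upper′ n
      -- All lower odd moments of the column vanish, so in the entry of x · x^(2n) the power x^(2n)
      -- may be replaced by Φ n, which gives V n 0 n.
      ; diag  = λ n → trans (sym (U-tail n 0 B (n ℕ.* 2))) (sym (Prod-leading a⁻ n λ i<n → trans (U-tail n 0 B _) (upper′ n i<n)))
      }
      where
      upper′ : ∀ n {i} → i < n → U n 0 B (suc (i ℕ.* 2)) ≡ 0ℚ
      upper′ n i<n = trans (sym (U-tail n 0 B _)) (Prod-zero a⁻ n (V-zero n) i<n)

    columns-monic : ∀ n → Monic B n (interleave (λ n → U n 0 B) n)
    columns-monic = interleave-All (Monic B) (λ n → U n 0 B) monic (Monic-tail ∘ monic)
      where
      monic : ∀ n → Monic B (n ℕ.* 2) (U n 0 B)
      monic n = subst (λ m → Monic B (m ℕ.* 2) (U n 0 B)) (ℕₚ.+-identityʳ n) (U-monic n 0)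

    H-even : ∀ m → H (m ℕ.* 2) B ≡ 0ℚ
    H-even m = trans (H-Monic columns-monic (m ℕ.* 2)) (detCols-odd m U-antidiagonal)

    H-odd : ∀ m → H (suc (m ℕ.* 2)) B ≡ product {suc m} (λ i → - (h (toℕ i) * h (toℕ i)))
    H-odd m = trans (H-Monic columns-monic (suc (m ℕ.* 2))) (detCols-even (suc m) U-antidiagonal)

-- Exponential generating functions and the translation rule.

⊛-congˡ : ∀ {f f′} g → f ≗ f′ → f ⊛ g ≗ f′ ⊛ g
⊛-congˡ g e n = sum-cong {suc n} λ i → cong (_* g (n ∸ toℕ i)) (e (toℕ i))

⊛-congʳ : ∀ f {g g′} → g ≗ g′ → f ⊛ g ≗ f ⊛ g′
⊛-congʳ f e n = sum-cong {suc n} λ i → cong (f (toℕ i) *_) (e (n ∸ toℕ i))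

⊛-combineˡ : ∀ f k f′ g → (f ⊕ k ⊙ f′) ⊛ g ≗ (f ⊛ g) ⊕ k ⊙ (f′ ⊛ g)
⊛-combineˡ f k f′ g n = begin
  sum {suc n} (λ i → (f (toℕ i) + k * f′ (toℕ i)) * g (n ∸ toℕ i))
    ≡⟨ sum-cong {suc n} (λ i → lemma (f (toℕ i)) k (f′ (toℕ i)) (g (n ∸ toℕ i))) ⟩
  sum {suc n} (λ i → f (toℕ i) * g (n ∸ toℕ i) + k * (f′ (toℕ i) * g (n ∸ toℕ i)))
    ≡⟨ sum-+ {suc n} (λ i → f (toℕ i) * g (n ∸ toℕ i)) (λ i → k * (f′ (toℕ i) * g (n ∸ toℕ i))) ⟩
  (f ⊛ g) n + sum {suc n} (λ i → k * (f′ (toℕ i) * g (n ∸ toℕ i)))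
    ≡⟨ cong ((f ⊛ g) n +_) (*-distribˡ-sum {suc n} k (λ i → f′ (toℕ i) * g (n ∸ toℕ i))) ⟨
  (f ⊛ g) n + k * (f′ ⊛ g) n ∎
  where
  open ≡-Reasoning
  lemma : ∀ x k y z → (x + k * y) * z ≡ x * z + k * (y * z)
  lemma = solve-∀ ℚ-ring

⊛-combineʳ : ∀ f g k g′ → f ⊛ (g ⊕ k ⊙ g′) ≗ (f ⊛ g) ⊕ k ⊙ (f ⊛ g′)
⊛-combineʳ f g k g′ n = begin
  sum {suc n} (λ i → f (toℕ i) * (g (n ∸ toℕ i) + k * g′ (n ∸ toℕ i)))
    ≡⟨ sum-cong {suc n} (λ i → lemma (f (toℕ i)) (g (n ∸ toℕ i)) k (g′ (n ∸ toℕ i))) ⟩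
  sum {suc n} (λ i → f (toℕ i) * g (n ∸ toℕ i) + k * (f (toℕ i) * g′ (n ∸ toℕ i)))
    ≡⟨ sum-+ {suc n} (λ i → f (toℕ i) * g (n ∸ toℕ i)) (λ i → k * (f (toℕ i) * g′ (n ∸ toℕ i))) ⟩
  (f ⊛ g) n + sum {suc n} (λ i → k * (f (toℕ i) * g′ (n ∸ toℕ i)))
    ≡⟨ cong ((f ⊛ g) n +_) (*-distribˡ-sum {suc n} k (λ i → f (toℕ i) * g′ (n ∸ toℕ i))) ⟨
  (f ⊛ g) n + k * (f ⊛ g′) n ∎
  where
  open ≡-Reasoning
  lemma : ∀ x y k z → x * (y + k * z) ≡ x * y + k * (x * z)
  lemma = solve-∀ ℚ-ring

⊛-one : ∀ f → f ⊛ one ≗ f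
⊛-one f zero    = trans (ℚₚ.+-identityʳ _) (ℚₚ.*-identityʳ (f 0))
⊛-one f (suc n) = trans (cong₂ _+_ (ℚₚ.*-zeroʳ (f 0)) (⊛-one (tail f) n)) (ℚₚ.+-identityˡ _)

⊛-t· : ∀ f g n → (f ⊛ t· g) (suc n) ≡ (f ⊛ g) n
⊛-t· f g zero    = cong (λ x → f 0 * g 0 + x) (trans (ℚₚ.+-identityʳ _) (ℚₚ.*-zeroʳ (f 1)))
⊛-t· f g (suc n) = cong (λ x → f 0 * g (suc n) + x) (⊛-t· (tail f) g n)

-- The operators t d/dt and d/dt. The product rule is proved first for θ, where it is just n = i +
-- (n - i) in each term of the convolution.
θ ∂ : Series → Series
θ f n = fromℕ n * f n
∂ = tail ∘ θ

θ-⊛ : ∀ f g → θ (f ⊛ g) ≗ (θ f ⊛ g) ⊕ (f ⊛ θ g)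
θ-⊛ f g n = begin
  fromℕ n * (f ⊛ g) n
    ≡⟨ *-distribˡ-sum {suc n} (fromℕ n) (λ i → f (toℕ i) * g (n ∸ toℕ i)) ⟩
  sum {suc n} (λ i → fromℕ n * (f (toℕ i) * g (n ∸ toℕ i)))
    ≡⟨ sum-cong {suc n} term ⟩
  sum {suc n} (λ i → θ f (toℕ i) * g (n ∸ toℕ i) + f (toℕ i) * θ g (n ∸ toℕ i))
    ≡⟨ sum-+ {suc n} (λ i → θ f (toℕ i) * g (n ∸ toℕ i)) (λ i → f (toℕ i) * θ g (n ∸ toℕ i)) ⟩
  (θ f ⊛ g) n + (f ⊛ θ g) n ∎
  where
  open ≡-Reasoning
  lemma : ∀ x y f g → (x + y) * (f * g) ≡ x * f * g + f * (y * g)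
  lemma = solve-∀ ℚ-ring
  term : ∀ (i : Fin (suc n)) → fromℕ n * (f (toℕ i) * g (n ∸ toℕ i)) ≡
         θ f (toℕ i) * g (n ∸ toℕ i) + f (toℕ i) * θ g (n ∸ toℕ i)
  term i = trans
    (cong (_* (f (toℕ i) * g (n ∸ toℕ i)))
      (trans (cong fromℕ (sym (ℕₚ.m+[n∸m]≡n (toℕ≤pred[n] i)))) (fromℕ-+ (toℕ i) (n ∸ toℕ i))))
    (lemma (fromℕ (toℕ i)) (fromℕ (n ∸ toℕ i)) (f (toℕ i)) (g (n ∸ toℕ i)))

∂-⊛ : ∀ f g → ∂ (f ⊛ g) ≗ (∂ f ⊛ g) ⊕ (f ⊛ ∂ g)
∂-⊛ f g n = begin
  ∂ (f ⊛ g) n                                               ≡⟨ θ-⊛ f g (suc n) ⟩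
  0ℚ * f 0 * g (suc n) + (∂ f ⊛ g) n + (f ⊛ θ g) (suc n)    ≡⟨ cong₂ (λ x y → x + (∂ f ⊛ g) n + y) (lemma (f 0) (g (suc n)))
                                                                 (trans (⊛-congʳ f θ≗t·∂ (suc n)) (⊛-t· f (∂ g) n)) ⟩
  0ℚ + (∂ f ⊛ g) n + (f ⊛ ∂ g) n                            ≡⟨ cong (_+ (f ⊛ ∂ g) n) (ℚₚ.+-identityˡ ((∂ f ⊛ g) n)) ⟩
  (∂ f ⊛ g) n + (f ⊛ ∂ g) n                                 ∎
  where
  open ≡-Reasoning
  lemma : ∀ x y → 0ℚ * x * y ≡ 0ℚ
  lemma = solve-∀ ℚ-ring
  θ≗t·∂ : θ g ≗ t· ∂ g
  θ≗t·∂ zero    = ℚₚ.*-zeroˡ (g 0)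
  θ≗t·∂ (suc n) = refl

1/! : ℕ → ℚ
1/! n = _/_ (ℤ.+ 1) (n !) {{n ℕₚ.!≢0}}

1/!-F : ∀ n → 1/! n * F n ≡ 1ℚ
1/!-F n = /-fromℕ (ℤ.+ 1) (n !) {{n ℕₚ.!≢0}}

1/!-suc : ∀ n → fromℕ (suc n) * 1/! (suc n) ≡ 1/! n
1/!-suc n = *-cancelʳ (F n) (F≢0 n) (begin
  fromℕ (suc n) * 1/! (suc n) * F n    ≡⟨ lemma (fromℕ (suc n)) (1/! (suc n)) (F n) ⟩
  1/! (suc n) * (fromℕ (suc n) * F n)  ≡⟨ cong (1/! (suc n) *_) (F-suc n) ⟨
  1/! (suc n) * F (suc n)              ≡⟨ 1/!-F (suc n) ⟩
  1ℚ                                   ≡⟨ 1/!-F n ⟨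
  1/! n * F n                          ∎)
  where
  open ≡-Reasoning
  lemma : ∀ x y z → x * y * z ≡ y * (x * z)
  lemma = solve-∀ ℚ-ring

egf-cancel : ∀ b c n → egf b n ≡ egf c n → b n ≡ c n
egf-cancel b c n = *-cancelʳ (1/! n) λ e →
  fromℕ-suc≢0 0 (trans (sym (1/!-F n)) (trans (cong (_* F n) e) (ℚₚ.*-zeroˡ (F n))))

egf-combine : ∀ b k c → egf (b ⊕ k ⊙ c) ≗ egf b ⊕ k ⊙ egf c
egf-combine b k c n = lemma (b n) k (c n) (1/! n)
  where
  lemma : ∀ x k y z → (x + k * y) * z ≡ x * z + k * (y * z)
  lemma = solve-∀ ℚ-ring

∂-egf : ∀ b → ∂ (egf b) ≗ egf (tail b)
∂-egf b n = trans (lemma (fromℕ (suc n)) (b (suc n)) (1/! (suc n))) (cong (b (suc n) *_) (1/!-suc n))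
  where
  lemma : ∀ x y z → x * (y * z) ≡ y * (x * z)
  lemma = solve-∀ ℚ-ring

fromℕ-^ : ∀ c n → fromℕ (c ℕ.^ n) ≡ fromℕ c ^ n
fromℕ-^ c zero    = refl
fromℕ-^ c (suc n) = trans (fromℕ-* c (c ℕ.^ n)) (cong (fromℕ c *_) (fromℕ-^ c n))

exp-egf : ∀ c → exp c ≗ egf (δ (fromℕ c))
exp-egf c n = *-cancelʳ (F n) (F≢0 n) (begin
  exp c n * F n                ≡⟨ /-fromℕ (ℤ.+ (c ℕ.^ n)) (n !) {{n ℕₚ.!≢0}} ⟩
  fromℕ (c ℕ.^ n)              ≡⟨ fromℕ-^ c n ⟩
  fromℕ c ^ n                  ≡⟨ ℚₚ.*-identityʳ _ ⟨
  fromℕ c ^ n * 1ℚ             ≡⟨ cong (fromℕ c ^ n *_) (1/!-F n) ⟨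
  fromℕ c ^ n * (1/! n * F n)  ≡⟨ ℚₚ.*-assoc (fromℕ c ^ n) (1/! n) (F n) ⟨
  fromℕ c ^ n * 1/! n * F n    ∎)
  where open ≡-Reasoning

∂-exp : ∀ c → ∂ (exp c) ≗ fromℕ c ⊙ exp c
∂-exp c n = begin
  fromℕ (suc n) * exp c (suc n)            ≡⟨ cong (fromℕ (suc n) *_) (exp-egf c (suc n)) ⟩
  ∂ (egf (δ (fromℕ c))) n                  ≡⟨ ∂-egf (δ (fromℕ c)) n ⟩
  fromℕ c * fromℕ c ^ n * 1/! n            ≡⟨ ℚₚ.*-assoc (fromℕ c) _ (1/! n) ⟩
  fromℕ c * egf (δ (fromℕ c)) n            ≡⟨ cong (fromℕ c *_) (exp-egf c n) ⟨
  fromℕ c * exp c n                        ∎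
  where open ≡-Reasoning

module _ (q : ℕ) where

  open Translation (fromℕ q) using (τ)

  -- Differentiating the product with e^{qt} replaces c by `tail c ⊕ fromℕ q ⊙ c`, which is
  -- precisely the recursion of τ; binomial coefficients never appear.
  egf-τ : ∀ c → egf c ⊛ exp q ≗ egf (τ c)
  egf-τ c zero    = lemma (c 0)
    where
    lemma : ∀ x → x * 1ℚ * 1ℚ + 0ℚ ≡ x * 1ℚ
    lemma = solve-∀ ℚ-ring
  egf-τ c (suc n) = *-cancelʳ (fromℕ (suc n)) (fromℕ-suc≢0 n) (begin
    (egf c ⊛ exp q) (suc n) * fromℕ (suc n)
      ≡⟨ ℚₚ.*-comm _ (fromℕ (suc n)) ⟩
    ∂ (egf c ⊛ exp q) n
      ≡⟨ ∂-⊛ (egf c) (exp q) n ⟩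
    (∂ (egf c) ⊛ exp q) n + (egf c ⊛ ∂ (exp q)) n
      ≡⟨ cong₂ _+_ (⊛-congˡ (exp q) (∂-egf c) n) (⊛-congʳ (egf c) (∂-exp q) n) ⟩
    (egf (tail c) ⊛ exp q) n + (egf c ⊛ (fromℕ q ⊙ exp q)) n
      ≡⟨ cong ((egf (tail c) ⊛ exp q) n +_) (sum-cong {suc n} λ i →
           lemma (egf c (toℕ i)) (fromℕ q) (exp q (n ∸ toℕ i))) ⟩
    (egf (tail c) ⊛ exp q) n + ((fromℕ q ⊙ egf c) ⊛ exp q) n
      ≡⟨ cong ((egf (tail c) ⊛ exp q) n +_) (⊛-⊙ (egf c)) ⟩
    (egf (tail c) ⊛ exp q) n + fromℕ q * (egf c ⊛ exp q) n
      ≡⟨ ⊛-combineˡ (egf (tail c)) (fromℕ q) (egf c) (exp q) n ⟨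
    ((egf (tail c) ⊕ fromℕ q ⊙ egf c) ⊛ exp q) n
      ≡⟨ ⊛-congˡ (exp q) (egf-combine (tail c) (fromℕ q) c) n ⟨
    (egf (tail c ⊕ fromℕ q ⊙ c) ⊛ exp q) n
      ≡⟨ egf-τ (tail c ⊕ fromℕ q ⊙ c) n ⟩
    egf (tail (τ c)) n
      ≡⟨ ∂-egf (τ c) n ⟨
    fromℕ (suc n) * egf (τ c) (suc n)
      ≡⟨ ℚₚ.*-comm (fromℕ (suc n)) _ ⟩
    egf (τ c) (suc n) * fromℕ (suc n) ∎)
    where
    open ≡-Reasoning
    lemma : ∀ x y z → x * (y * z) ≡ y * x * z
    lemma = solve-∀ ℚ-ring
    ⊛-⊙ : ∀ f → ((fromℕ q ⊙ f) ⊛ exp q) n ≡ fromℕ q * (f ⊛ exp q) n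
    ⊛-⊙ f = trans (sum-cong {suc n} λ i → ℚₚ.*-assoc (fromℕ q) (f (toℕ i)) (exp q (n ∸ toℕ i)))
                  (sym (*-distribˡ-sum {suc n} (fromℕ q) (λ i → f (toℕ i) * exp q (n ∸ toℕ i))))

-- This is the derivative of e^{xt} with respect to x.
d-egf : ∀ x → egf (d x) ≗ t· egf (δ x)
d-egf x zero    = refl
d-egf x (suc n) = trans (lemma (fromℕ (suc n)) (x ^ n) (1/! (suc n))) (cong (x ^ n *_) (1/!-suc n))
  where
  lemma : ∀ m y z → m * y * z ≡ y * (m * z)
  lemma = solve-∀ ℚ-ring

module _ (q : ℕ) .{{_ : NonZero q}} (ψ : ℕ → ℚ) {r s : ℕ} (ψ-sum : charSum q ψ ≗ exp r ⊖ exp s) where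

  open Translation (fromℕ q) using (τ)

  private
    B : Series
    B = genBernoulli q ψ

  -- Compare coefficients in the defining identity: multiplication by e^{qt} - 1 becomes τ minus the
  -- identity, and t(e^{rt} - e^{st}) generates the derivatives at r and s.
  genBernoulli-τ : τ B ≗ B ⊕ (d (fromℕ r) ⊕ (- 1ℚ) ⊙ d (fromℕ s))
  genBernoulli-τ n = egf-cancel (τ B) (B ⊕ D) n (begin
    egf (τ B) n
      ≡⟨ lemma₁ (egf (τ B) n) (egf B n) ⟩
    egf B n + 1ℚ * (egf (τ B) n + - 1ℚ * egf B n)
      ≡⟨ cong (λ x → egf B n + 1ℚ * x) (cong₂ (λ x y → x + - 1ℚ * y) (egf-τ q B n) (⊛-one (egf B) n)) ⟨
    egf B n + 1ℚ * ((egf B ⊛ exp q) n + - 1ℚ * (egf B ⊛ one) n)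
      ≡⟨ cong (λ x → egf B n + 1ℚ * x) (⊛-combineʳ (egf B) (exp q) (- 1ℚ) one n) ⟨
    egf B n + 1ℚ * (egf B ⊛ (exp q ⊕ (- 1ℚ) ⊙ one)) n
      ≡⟨ cong (λ x → egf B n + 1ℚ * x) (⊛-congʳ (egf B) (λ i → lemma₂ (exp q i) (one i)) n) ⟩
    egf B n + 1ℚ * (egf B ⊛ (exp q ⊖ one)) n
      ≡⟨ cong (λ x → egf B n + 1ℚ * x) (genBernoulli-egf q ψ n) ⟩
    egf B n + 1ℚ * (t· charSum q ψ) n
      ≡⟨ cong (λ x → egf B n + 1ℚ * x) (right n) ⟩
    egf B n + 1ℚ * egf D n
      ≡⟨ egf-combine B 1ℚ D n ⟨
    egf (B ⊕ 1ℚ ⊙ D) n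
      ≡⟨ cong (λ x → (B n + x) * 1/! n) (ℚₚ.*-identityˡ (D n)) ⟩
    egf (B ⊕ D) n ∎)
    where
    open ≡-Reasoning
    D = d (fromℕ r) ⊕ (- 1ℚ) ⊙ d (fromℕ s)
    lemma₁ : ∀ x y → x ≡ y + 1ℚ * (x + - 1ℚ * y)
    lemma₁ = solve-∀ ℚ-ring
    lemma₂ : ∀ x y → x + - 1ℚ * y ≡ x - y
    lemma₂ = solve-∀ ℚ-ring
    right : t· charSum q ψ ≗ egf D
    right zero    = refl
    right (suc n) = begin
      charSum q ψ n                                          ≡⟨ ψ-sum n ⟩
      exp r n - exp s n                                      ≡⟨ cong₂ _-_ (exp-egf r n) (exp-egf s n) ⟩
      egf (δ (fromℕ r)) n - egf (δ (fromℕ s)) n              ≡⟨ lemma₂ (egf (δ (fromℕ r)) n) (egf (δ (fromℕ s)) n) ⟨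
      egf (δ (fromℕ r)) n + - 1ℚ * egf (δ (fromℕ s)) n       ≡⟨ cong₂ (λ x y → x + - 1ℚ * y) (d-egf (fromℕ r) (suc n)) (d-egf (fromℕ s) (suc n)) ⟨
      egf (d (fromℕ r)) (suc n) + - 1ℚ * egf (d (fromℕ s)) (suc n) ≡⟨ egf-combine (d (fromℕ r)) (- 1ℚ) (d (fromℕ s)) (suc n) ⟨
      egf D (suc n)                                          ∎

-- Closed form of the product of the block determinants.

product-snoc : ∀ m (f : ℕ → ℚ) → product {suc m} (f ∘ toℕ) ≡ product {m} (f ∘ toℕ) * f m
product-snoc zero    f = trans (ℚₚ.*-identityʳ (f 0)) (sym (ℚₚ.*-identityˡ (f 0)))
product-snoc (suc m) f = trans (cong (f 0 *_) (product-snoc m (f ∘ suc))) (sym (ℚₚ.*-assoc (f 0) _ _))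

^-double : ∀ x k → x ^ (2 ℕ.* k) ≡ (x * x) ^ k
^-double x k = trans (sym (^-assocʳ x 2 k)) (cong (λ y → (x * y) ^ k) (ℚₚ.*-identityʳ x))

-- The closed form of ∏_{n≤m} (-(h n)²) when h n = ± y 0 ∏_{i<n} Q² φ i.
module _ (Q : ℚ) (φ y h : ℕ → ℚ) (y-suc : ∀ m → y (suc m) ≡ Q * y m) (h-0 : h 0 * h 0 ≡ y 0 * y 0)
         (h-suc : ∀ n → h (suc n) ≡ - (Q * Q) * φ n * h n) where

  private
    f : ℕ → ℚ
    f i = φ i * φ i

    P : ℕ → ℚ
    P m = product {m} (λ i → f (toℕ i) ^ (m ∸ toℕ i))

    -- Every exponent rises by one, and the new last factor had exponent m - m = 0 before.
    P-suc : ∀ m → P (suc m) ≡ product {suc m} (f ∘ toℕ) * P m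
    P-suc m = begin
      P (suc m)
        ≡⟨ product-cong {suc m} (λ i → cong (f (toℕ i) ^_) (ℕₚ.+-∸-assoc 1 (toℕ≤pred[n] i))) ⟩
      product {suc m} (λ i → f (toℕ i) * f (toℕ i) ^ (m ∸ toℕ i))
        ≡⟨ product-* {suc m} (f ∘ toℕ) (λ i → f (toℕ i) ^ (m ∸ toℕ i)) ⟩
      product {suc m} (f ∘ toℕ) * product {suc m} (λ i → f (toℕ i) ^ (m ∸ toℕ i))
        ≡⟨ cong (product {suc m} (f ∘ toℕ) *_) (trans (product-snoc m (λ i → f i ^ (m ∸ i)))
             (trans (cong (λ k → P m * f m ^ k) (ℕₚ.n∸n≡0 m)) (ℚₚ.*-identityʳ (P m)))) ⟩
      product {suc m} (f ∘ toℕ) * P m ∎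
      where open ≡-Reasoning

    -- Each step gains Q⁴, split evenly between the explicit power and (y m)². In `squares` the
    -- explicit power is then exactly what turns y m into y (m + 1) in all earlier factors.
    h-square : ∀ m → h m * h m ≡ (Q * Q) ^ m * (y m * y m) * product {m} (f ∘ toℕ)
    h-square zero    = trans h-0 (lemma (y 0))
      where
      lemma : ∀ y → y * y ≡ 1ℚ * (y * y) * 1ℚ
      lemma = solve-∀ ℚ-ring
    h-square (suc m) = begin
      h (suc m) * h (suc m)
        ≡⟨ cong (λ x → x * x) (h-suc m) ⟩
      (- (Q * Q) * φ m * h m) * (- (Q * Q) * φ m * h m)
        ≡⟨ lemma₁ Q (φ m) (h m) ⟩
      Q * Q * (Q * Q) * f m * (h m * h m)
        ≡⟨ cong (Q * Q * (Q * Q) * f m *_) (h-square m) ⟩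
      Q * Q * (Q * Q) * f m * ((Q * Q) ^ m * (y m * y m) * product {m} (f ∘ toℕ))
        ≡⟨ lemma₂ Q (f m) ((Q * Q) ^ m) (y m) (product {m} (f ∘ toℕ)) ⟩
      Q * Q * (Q * Q) ^ m * (Q * y m * (Q * y m)) * (product {m} (f ∘ toℕ) * f m)
        ≡⟨ cong₂ (λ x z → (Q * Q) ^ suc m * (x * x) * z) (y-suc m) (product-snoc m f) ⟨
      (Q * Q) ^ suc m * (y (suc m) * y (suc m)) * product {suc m} (f ∘ toℕ) ∎
      where
      open ≡-Reasoning
      lemma₁ : ∀ q p h → (- (q * q) * p * h) * (- (q * q) * p * h) ≡ q * q * (q * q) * (p * p) * (h * h)
      lemma₁ = solve-∀ ℚ-ring
      lemma₂ : ∀ q f e y p → q * q * (q * q) * f * (e * (y * y) * p) ≡ q * q * e * (q * y * (q * y)) * (p * f)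
      lemma₂ = solve-∀ ℚ-ring

    squares : ∀ m → product {suc m} (λ i → - (h (toℕ i) * h (toℕ i))) ≡
              (- 1ℚ) ^ suc m * (y m * y m) ^ suc m * P m
    squares zero    = trans (cong (λ x → - x * 1ℚ) h-0) (lemma (y 0))
      where
      lemma : ∀ y → - (y * y) * 1ℚ ≡ - 1ℚ * 1ℚ * (y * y * 1ℚ) * 1ℚ
      lemma = solve-∀ ℚ-ring
    squares (suc m) = begin
      product {suc (suc m)} (λ i → - (h (toℕ i) * h (toℕ i)))
        ≡⟨ product-snoc (suc m) (λ i → - (h i * h i)) ⟩
      product {suc m} (λ i → - (h (toℕ i) * h (toℕ i))) * - (h (suc m) * h (suc m))
        ≡⟨ cong₂ (λ u v → u * - v) (squares m) (h-square (suc m)) ⟩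
      (- 1ℚ) ^ suc m * z ^ suc m * P m * - ((Q * Q) ^ suc m * z′ * S)
        ≡⟨ lemma₁ ((- 1ℚ) ^ suc m) (z ^ suc m) (P m) ((Q * Q) ^ suc m) z′ S ⟩
      - 1ℚ * (- 1ℚ) ^ suc m * (z′ * ((Q * Q) ^ suc m * z ^ suc m)) * (S * P m)
        ≡⟨ cong₂ (λ u v → - 1ℚ * (- 1ℚ) ^ suc m * (z′ * u) * v) power (sym (P-suc m)) ⟩
      - 1ℚ * (- 1ℚ) ^ suc m * (z′ * z′ ^ suc m) * P (suc m) ∎
      where
      open ≡-Reasoning
      z  = y m * y m
      z′ = y (suc m) * y (suc m)
      S  = product {suc m} (f ∘ toℕ)
      lemma₁ : ∀ s e p k z S → s * e * p * - (k * z * S) ≡ - 1ℚ * s * (z * (k * e)) * (S * p)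
      lemma₁ = solve-∀ ℚ-ring
      lemma₂ : ∀ q y → q * q * (y * y) ≡ q * y * (q * y)
      lemma₂ = solve-∀ ℚ-ring
      power : (Q * Q) ^ suc m * z ^ suc m ≡ z′ ^ suc m
      power = trans (sym (^-distrib-* (Q * Q) z (suc m)))
        (cong (_^ suc m) (trans (lemma₂ Q (y m)) (cong (λ x → x * x) (sym (y-suc m)))))

  product-squares : ∀ m → product {suc m} (λ i → - (h (toℕ i) * h (toℕ i))) ≡
    (- 1ℚ) ^ (m ℕ.+ 1) * y m ^ (2 ℕ.* m ℕ.+ 2) * product {m} (λ i → φ (toℕ i) ^ (2 ℕ.* (m ℕ.+ 1 ∸ suc (toℕ i))))
  product-squares m = trans (squares m) (sym (cong₂ _*_
    (cong₂ _*_ (cong ((- 1ℚ) ^_) (ℕₚ.+-comm m 1))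
      (trans (cong (y m ^_) (trans (ℕₚ.+-comm (2 ℕ.* m) 2) (sym (ℕₚ.*-suc 2 m)))) (^-double (y m) (suc m))))
    (product-cong {m} λ i → trans (cong (λ k → φ (toℕ i) ^ (2 ℕ.* (k ∸ suc (toℕ i)))) (ℕₚ.+-comm m 1))
      (^-double (φ (toℕ i)) (m ∸ toℕ i)))))

-- Specialization to the generalized Bernoulli numbers.

fromℤ-^ : ∀ i n → fromℤ (i ℤ.^ n) ≡ fromℤ i ^ n
fromℤ-^ i zero    = refl
fromℤ-^ i (suc n) = trans (fromℤ-* i (i ℤ.^ n)) (cong (fromℤ i *_) (fromℤ-^ i n))

factor-value : ∀ q n → let x = fromℕ (suc n); Q = fromℕ q in
  factor q (suc n) * ((1ℚ + 1ℚ) * (1ℚ + 1ℚ) * (x + x + 1ℚ) * (x + x - 1ℚ)) ≡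
  x * x * (x * x) * ((Q - (1ℚ + 1ℚ)) * (Q - (1ℚ + 1ℚ)) - Q * x * (Q * x))
factor-value q n = begin
  factor q (suc n) * ((1ℚ + 1ℚ) * (1ℚ + 1ℚ) * (x + x + 1ℚ) * (x + x - 1ℚ))
    ≡⟨ cong (factor q (suc n) *_) denominator ⟨
  factor q (suc n) * fromℕ (4 ℕ.* (2 ℕ.* suc n ℕ.+ 1) ℕ.* (2 ℕ.* suc n ∸ 1))
    ≡⟨ /-fromℕ (ℓ ℤ.^ 4 ℤ.* (u ℤ.^ 2 ℤ.- v ℤ.^ 2)) (4 ℕ.* (2 ℕ.* suc n ℕ.+ 1) ℕ.* (2 ℕ.* suc n ∸ 1)) {{nonZero}} ⟩
  fromℤ (ℓ ℤ.^ 4 ℤ.* (u ℤ.^ 2 ℤ.- v ℤ.^ 2))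
    ≡⟨ trans (fromℤ-* (ℓ ℤ.^ 4) (u ℤ.^ 2 ℤ.- v ℤ.^ 2)) (cong₂ _*_ (fromℤ-^ ℓ 4)
         (trans (fromℤ-- (u ℤ.^ 2) (v ℤ.^ 2)) (cong₂ _-_
           (trans (fromℤ-^ u 2) (cong (_^ 2) (fromℤ-- (ℤ.+ q) (ℤ.+ 2))))
           (trans (fromℤ-^ v 2) (cong (_^ 2) (fromℤ-* (ℤ.+ q) ℓ)))))) ⟩
  x ^ 4 * ((fromℕ q - (1ℚ + 1ℚ)) ^ 2 - (fromℕ q * x) ^ 2)
    ≡⟨ lemma₂ x (fromℕ q) ⟩
  x * x * (x * x) * ((fromℕ q - (1ℚ + 1ℚ)) * (fromℕ q - (1ℚ + 1ℚ)) - fromℕ q * x * (fromℕ q * x)) ∎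
  where
  open ≡-Reasoning
  x = fromℕ (suc n)
  ℓ = ℤ.+ suc n
  u = ℤ.+ q ℤ.- ℤ.+ 2
  v = ℤ.+ q ℤ.* ℓ
  lemma₂ : ∀ x q → x * (x * (x * (x * 1ℚ))) * ((q - (1ℚ + 1ℚ)) * ((q - (1ℚ + 1ℚ)) * 1ℚ) - q * x * (q * x * 1ℚ)) ≡
           x * x * (x * x) * ((q - (1ℚ + 1ℚ)) * (q - (1ℚ + 1ℚ)) - q * x * (q * x))
  lemma₂ = solve-∀ ℚ-ring
  odd : 2 ℕ.* suc n ∸ 1 ≡ suc (n ℕ.+ n)
  odd = trans (ℕₚ.+-suc n (n ℕ.+ 0)) (cong (λ k → suc (n ℕ.+ k)) (ℕₚ.+-identityʳ n))
  nonZero : NonZero (4 ℕ.* (2 ℕ.* suc n ℕ.+ 1) ℕ.* (2 ℕ.* suc n ∸ 1))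
  nonZero rewrite odd = _
  lemma₃ : ∀ n → 1ℚ + (n + n) ≡ 1ℚ + n + (1ℚ + n) - 1ℚ
  lemma₃ = solve-∀ ℚ-ring
  lemma₄ : ∀ x → (1ℚ + 1ℚ) * x + 1ℚ ≡ x + x + 1ℚ
  lemma₄ = solve-∀ ℚ-ring
  denominator : fromℕ (4 ℕ.* (2 ℕ.* suc n ℕ.+ 1) ℕ.* (2 ℕ.* suc n ∸ 1)) ≡
                (1ℚ + 1ℚ) * (1ℚ + 1ℚ) * (x + x + 1ℚ) * (x + x - 1ℚ)
  denominator = trans (fromℕ-* (4 ℕ.* (2 ℕ.* suc n ℕ.+ 1)) (2 ℕ.* suc n ∸ 1)) (cong₂ _*_
    (trans (fromℕ-* 4 (2 ℕ.* suc n ℕ.+ 1)) (cong ((1ℚ + 1ℚ) * (1ℚ + 1ℚ) *_)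
      (trans (fromℕ-+ (2 ℕ.* suc n) 1) (trans (cong (_+ 1ℚ) (fromℕ-* 2 (suc n))) (lemma₄ x)))))
    (trans (cong fromℕ odd) (trans (fromℕ-suc (n ℕ.+ n)) (trans (cong (λ k → 1ℚ + k) (fromℕ-+ n n))
      (trans (lemma₃ (fromℕ n)) (cong (λ k → k + k - 1ℚ) (sym (fromℕ-suc n))))))))

^ᶻ-suc : ∀ q .{{_ : NonZero q}} m → q ^ᶻ (ℤ.+ suc m ℤ.- ℤ.+ 1) ≡ fromℕ q * q ^ᶻ (ℤ.+ m ℤ.- ℤ.+ 1)
-- The passage from exponent -1 to 0, where q · (1/q) = 1 is needed.
^ᶻ-suc q zero    = sym (trans (cong (fromℕ q *_) (ℚₚ.*-identityʳ (ℤ.+ 1 / q)))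
                     (trans (ℚₚ.*-comm (fromℕ q) (ℤ.+ 1 / q)) (/-fromℕ (ℤ.+ 1) q)))
^ᶻ-suc q (suc m) = refl

module _ (q : ℕ) .{{_ : NonZero q}} (ψ : ℕ → ℚ) (ψ-sum : charSum q ψ ≗ exp 1 ⊖ exp (q ∸ 1)) where

  private
    Q = fromℕ q
    B = genBernoulli q ψ

    Q≢0 : Q ≢ 0ℚ
    Q≢0 = fromℕ≢0 q

    y : ℕ → ℚ
    y m = q ^ᶻ (ℤ.+ m ℤ.- ℤ.+ 1) * (fromℕ q - fromℕ 2)

  open Translation Q
  open Moments Q Q≢0 B
  open Elimination Q Q≢0 B

  τB : τ B ≗ B ⊕ D₀
  τB n = trans (genBernoulli-τ q ψ ψ-sum n)
    (cong₂ (λ r s → B n + (d r n + - 1ℚ * d s n)) (lemma₁ Q) (trans q-1 (lemma₂ Q)))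
    where
    lemma₁ : ∀ q → 1ℚ ≡ 1ℚ + q * 0ℚ
    lemma₁ = solve-∀ ℚ-ring
    lemma₂ : ∀ q → q - 1ℚ ≡ - (1ℚ - q * 1ℚ)
    lemma₂ = solve-∀ ℚ-ring
    lemma₃ : ∀ x → x ≡ x + 1ℚ - 1ℚ
    lemma₃ = solve-∀ ℚ-ring
    q-1 : fromℕ (q ∸ 1) ≡ Q - 1ℚ
    q-1 = trans (lemma₃ (fromℕ (q ∸ 1))) (cong (_- 1ℚ) (trans (sym (fromℕ-+ (q ∸ 1) 1))
      (cong fromℕ (ℕₚ.m∸n+n≡m (ℕ.>-nonZero⁻¹ q)))))

  -- Here h 0 = B 1 = (2 - Q)/Q is the negative of y 0, so the comparison is made between squares.
  h-0-square : h 0 * h 0 ≡ y 0 * y 0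
  h-0-square = *-cancelʳ (Q * Q) (*-≢0 Q≢0 Q≢0) (begin
    B 1 * B 1 * (Q * Q)       ≡⟨ lemma₁ (B 1) Q ⟩
    B 1 * Q * (B 1 * Q)       ≡⟨ cong (λ x → x * x) (moment-1 τB) ⟩
    κ * κ                     ≡⟨ lemma₂ Q ⟩
    (Q - (1ℚ + 1ℚ)) * (Q - (1ℚ + 1ℚ))
                              ≡⟨ cong (λ x → x * x) (trans (cong (_* (Q - (1ℚ + 1ℚ))) (sym (^ᶻ-suc q 0))) (ℚₚ.*-identityˡ (Q - (1ℚ + 1ℚ)))) ⟨
    Q * p * (Q - (1ℚ + 1ℚ)) * (Q * p * (Q - (1ℚ + 1ℚ)))
                              ≡⟨ lemma₃ Q p ⟩
    y 0 * y 0 * (Q * Q)       ∎)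
    where
    open ≡-Reasoning
    p = q ^ᶻ (ℤ.+ 0 ℤ.- ℤ.+ 1)
    lemma₁ : ∀ x q → x * x * (q * q) ≡ x * q * (x * q)
    lemma₁ = solve-∀ ℚ-ring
    lemma₂ : ∀ q → (1ℚ + q * 0ℚ - - (1ℚ - q * 1ℚ)) * (1ℚ + q * 0ℚ - - (1ℚ - q * 1ℚ)) ≡ (q - (1ℚ + 1ℚ)) * (q - (1ℚ + 1ℚ))
    lemma₂ = solve-∀ ℚ-ring
    lemma₃ : ∀ q p → q * p * (q - (1ℚ + 1ℚ)) * (q * p * (q - (1ℚ + 1ℚ))) ≡ p * (q - (1ℚ + 1ℚ)) * (p * (q - (1ℚ + 1ℚ))) * (q * q)
    lemma₃ = solve-∀ ℚ-ring

  h-factor : ∀ n → h (suc n) ≡ - (Q * Q) * factor q (suc n) * h n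
  h-factor n = *-cancelʳ D (*-≢0 (*-≢0 (*-≢0 (fromℕ-suc≢0 1) (fromℕ-suc≢0 1)) plus≢0) minus≢0) (begin
    h (suc n) * D                               ≡⟨ h-suc τB n ⟩
    - (Q * Q) * N * h n                         ≡⟨ cong (λ z → - (Q * Q) * z * h n) (factor-value q n) ⟨
    - (Q * Q) * (factor q (suc n) * D) * h n    ≡⟨ lemma₁ (- (Q * Q)) (factor q (suc n)) D (h n) ⟩
    - (Q * Q) * factor q (suc n) * h n * D      ∎)
    where
    open ≡-Reasoning
    x = fromℕ (suc n)
    D = (1ℚ + 1ℚ) * (1ℚ + 1ℚ) * (x + x + 1ℚ) * (x + x - 1ℚ)
    N = x * x * (x * x) * ((Q - (1ℚ + 1ℚ)) * (Q - (1ℚ + 1ℚ)) - Q * x * (Q * x))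
    lemma₁ : ∀ p f d h → p * (f * d) * h ≡ p * f * h * d
    lemma₁ = solve-∀ ℚ-ring
    lemma₂ : ∀ n → 1ℚ + (n + n) ≡ 1ℚ + n + (1ℚ + n) - 1ℚ
    lemma₂ = solve-∀ ℚ-ring
    plus≢0 : x + x + 1ℚ ≢ 0ℚ
    plus≢0 e = fromℕ-suc≢0 (suc n ℕ.+ suc n) (trans (fromℕ-suc (suc n ℕ.+ suc n))
      (trans (ℚₚ.+-comm 1ℚ (fromℕ (suc n ℕ.+ suc n))) (trans (cong (_+ 1ℚ) (fromℕ-+ (suc n) (suc n))) e)))
    minus≢0 : x + x - 1ℚ ≢ 0ℚ
    minus≢0 e = fromℕ-suc≢0 (n ℕ.+ n) (trans (fromℕ-suc (n ℕ.+ n)) (trans (cong (λ z → 1ℚ + z) (fromℕ-+ n n))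
      (trans (lemma₂ (fromℕ n)) (trans (cong (λ z → z + z - 1ℚ) (sym (fromℕ-suc n))) e))))

  hankel : ∀ m → H (2 ℕ.* m) B ≡ 0ℚ
    × H (2 ℕ.* m ℕ.+ 1) B ≡ (- 1ℚ) ^ (m ℕ.+ 1) * y m ^ (2 ℕ.* m ℕ.+ 2) * ∏₁ m (λ ℓ → factor q ℓ ^ (2 ℕ.* (m ℕ.+ 1 ∸ ℓ)))
  hankel m =
    trans (cong (λ k → H k B) (ℕₚ.*-comm 2 m)) (H-even τB m) ,
    trans (cong (λ k → H k B) (trans (ℕₚ.+-comm (2 ℕ.* m) 1) (cong suc (ℕₚ.*-comm 2 m))))
      (trans (H-odd τB m) (product-squares Q (λ i → factor q (suc i)) y h y-suc h-0-square h-factor m))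
    where
    y-suc : ∀ m → y (suc m) ≡ Q * y m
    y-suc m = trans (cong (_* (fromℕ q - fromℕ 2)) (^ᶻ-suc q m)) (ℚₚ.*-assoc Q _ (fromℕ q - fromℕ 2))

-- For concrete q the character values compute, and the terms at residues other than 1 and q - 1
-- carry the coefficient 0.
charSum-χ : ∀ q .{{_ : NonZero q}} → q ≡ 3 ⊎ q ≡ 4 ⊎ q ≡ 6 → charSum q (χ q) ≗ exp 1 ⊖ exp (q ∸ 1)
charSum-χ q (inj₁ refl) n = lemma (exp 1 n) (exp 2 n) (exp 3 n)
  where
  lemma : ∀ x y z → 1ℚ * x + (- 1ℚ * y + (0ℚ * z + 0ℚ)) ≡ x - y
  lemma = solve-∀ ℚ-ring
charSum-χ q (inj₂ (inj₁ refl)) n = lemma (exp 1 n) (exp 2 n) (exp 3 n) (exp 4 n)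
  where
  lemma : ∀ x a y z → 1ℚ * x + (0ℚ * a + (- 1ℚ * y + (0ℚ * z + 0ℚ))) ≡ x - y
  lemma = solve-∀ ℚ-ring
charSum-χ q (inj₂ (inj₂ refl)) n = lemma (exp 1 n) (exp 2 n) (exp 3 n) (exp 4 n) (exp 5 n) (exp 6 n)
  where
  lemma : ∀ x a b c y z → 1ℚ * x + (0ℚ * a + (0ℚ * b + (0ℚ * c + (- 1ℚ * y + (0ℚ * z + 0ℚ))))) ≡ x - y
  lemma = solve-∀ ℚ-ring

open import Data.Integer.Base using (+_)

corollary3p5 : ∀ (q : ℕ) .{{_ : NonZero q}} → q ≡ 3 ⊎ q ≡ 4 ⊎ q ≡ 6 → (m : ℕ) →
    H (2 ℕ.* m) (genBernoulli q (χ q)) ≡ 0ℚ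
    × H (2 ℕ.* m ℕ.+ 1) (genBernoulli q (χ q))
    ≡ (- 1ℚ) ^ (m ℕ.+ 1)
    * (q ^ᶻ (+ m ℤ.- + 1) * (fromℕ q - fromℕ 2)) ^ (2 ℕ.* m ℕ.+ 2)
    * ∏₁ m (λ ℓ → factor q ℓ ^ (2 ℕ.* (m ℕ.+ 1 ∸ ℓ)))
corollary3p5 q q∈ m = hankel q (χ q) (charSum-χ q q∈) m
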